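{- There is an absolute constant $C>0$ such that the following holds. Let $G=(V,E)$ be any connected $n$-node graph with diameter $D$ and minor density $\delta=\delta(G)$. Then for every partition of $V$ into parts $P_1,\dots,P_k$ such that each induced subgraph $G[P_i]$ is connected, there exists a shortcut $H_1,\dots,H_k$ for $P_1,\dots,P_k$ with dilation at most $C\,\delta D$ and congestion at most $C\,\delta D\log n$.
   Context: Minor: a graph $H=(V',E')$ is a minor of $G$ if $H$ can be obtained from $G$ by deleting vertices/edges and contracting edges. The minor density of $G$ is $\delta(G)=\max\{|E'|/|V'| : H=(V',E') \text{ is a minor of } G\}$. Given pairwise disjoint vertex sets $P_1,\dots,P_k$ of $G$, each inducing a connected subgraph, a shortcut is a collection of subgraphs $H_1,\dots,H_k$ of $G$. Its congestion is the maximum, over edges $e\in E$, of the number of indices $i$ with $e\in H_i$. Its dilation is the maximum over $i$ of the diameter of the graph $G[P_i]+H_i$, whose vertex set is $P_i\cup V(H_i)$ and whose edge set is the union of the edges of $G[P_i]$ and of $H_i$. -}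

module Defs where

open import Data.Nat using (ℕ; zero; suc; _≤_; _<_)
open import Data.Nat.Logarithm using (⌈log₂_⌉)
open import Data.Fin using (Fin; zero; suc; punchIn; toℕ)
open import Data.Fin.Properties using (_≟_)
open import Data.Bool using (Bool; true; false; _∧_; _∨_; not; if_then_else_)
open import Data.Integer using (+_)
open import Data.Rational using (ℚ; _/_; _*_) renaming (_≤_ to _≤ℚ_)
open import Data.Product using (Σ; ∃; ∃-syntax; _×_; _,_)
open import Data.Sum using (_⊎_)
open import Relation.Nullary using (¬_)
open import Relation.Nullary.Decidable using (⌊_⌋)
open import Relation.Binary.PropositionalEquality using (_≡_; _≢_)

-- Graphs.
-- A (finite, simple, undirected) graph on the vertex set Fin n is given
-- by a Boolean matrix; its edge set is the SYMMETRIC, LOOP-FREE reading: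
-- {u,v} is an edge iff u ≢ v and (adj u v ∨ adj v u) is true.

Adj : ℕ → Set
Adj n = Fin n → Fin n → Bool

distinctB : ∀ {n} → Fin n → Fin n → Bool
distinctB u v = not ⌊ u ≟ v ⌋

eqB : ∀ {n} → Fin n → Fin n → Bool
eqB u v = ⌊ u ≟ v ⌋

edgeB : ∀ {n} → Adj n → Fin n → Fin n → Bool
edgeB G u v = distinctB u v ∧ (G u v ∨ G v u)

E : ∀ {n} → Adj n → Fin n → Fin n → Set
E G u v = edgeB G u v ≡ true

countTrue : ∀ {k} → (Fin k → Bool) → ℕ
countTrue {zero}  f = 0
countTrue {suc k} f = (if f zero then 1 else 0) Data.Nat.+ countTrue (λ i → f (suc i))

numEdges : ∀ {n} → Adj n → ℕ
numEdges {n} G = sumFin (λ u → countTrue (λ v → ⌊ toℕ u Data.Nat.<? toℕ v ⌋ ∧ edgeB G u v))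
  where
  sumFin : ∀ {m} → (Fin m → ℕ) → ℕ
  sumFin {zero}  f = 0
  sumFin {suc m} f = f zero Data.Nat.+ sumFin (λ i → f (suc i))

removeE : ∀ {n} → Adj n → Fin n → Fin n → Adj n
removeE G u v x y = G x y ∧ not ((eqB x u ∧ eqB y v) ∨ (eqB x v ∧ eqB y u))

removeV : ∀ {n} → Adj (suc n) → Fin (suc n) → Adj n
removeV G v x y = G (punchIn v x) (punchIn v y)

-- contract the edge {u,v}: v is merged into u (the merged vertex keeps
-- the name of u, v is removed, all neighbours of v become neighbours of u)
contract : ∀ {n} → Adj (suc n) → Fin (suc n) → Fin (suc n) → Adj n
contract G u v x y =
  G x' y' ∨ ((eqB x' u ∧ (G v y' ∨ G y' v)) ∨ (eqB y' u ∧ (G x' v ∨ G v x')))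
  where
  x' = punchIn v x
  y' = punchIn v y

data Minor : ∀ {m n} → Adj m → Adj n → Set where
  done     : ∀ {n} {G : Adj n} → Minor G G
  delV     : ∀ {m n} {H : Adj m} {G : Adj (suc n)} (v : Fin (suc n)) →
             Minor H (removeV G v) → Minor H G
  delE     : ∀ {m n} {H : Adj m} {G : Adj n} (u v : Fin n) → E G u v →
             Minor H (removeE G u v) → Minor H G
  contrE   : ∀ {m n} {H : Adj m} {G : Adj (suc n)} (u v : Fin (suc n)) → E G u v →
             Minor H (contract G u v) → Minor H G

ratio : ∀ {m} → Adj (suc m) → ℚ
ratio {m} H = (+ numEdges H) / suc m

IsMinorDensity : ∀ {n} → Adj n → ℚ → Set
IsMinorDensity G δ =
  (∃[ m ] Σ (Adj (suc m)) λ H → Minor H G × δ ≡ ratio H) ×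
  (∀ m (H : Adj (suc m)) → Minor H G → ratio H ≤ℚ δ)

data Walk {n} (R : Fin n → Fin n → Set) : Fin n → Fin n → ℕ → Set where
  []   : ∀ {u} → Walk R u u 0
  _∷_  : ∀ {u w v ℓ} → R u w → Walk R w v ℓ → Walk R u v (suc ℓ)

Connected : ∀ {n} → Adj n → Set
Connected G = ∀ u v → ∃[ ℓ ] Walk (E G) u v ℓ

IsDiameter : ∀ {n} → Adj n → ℕ → Set
IsDiameter G D =
  (∀ u v → ∃[ ℓ ] (ℓ ≤ D × Walk (E G) u v ℓ)) ×
  (∃[ u ] ∃[ v ] (∀ ℓ → Walk (E G) u v ℓ → D ≤ ℓ))

-- Partitions into parts P_1..P_k, given by  part : Fin n → Fin k
-- (P_i = { u | part u ≡ i }).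

InducedE : ∀ {n k} → Adj n → (Fin n → Fin k) → Fin k → Fin n → Fin n → Set
InducedE G part i x y = E G x y × part x ≡ i × part y ≡ i

PartConnected : ∀ {n k} → Adj n → (Fin n → Fin k) → Fin k → Set
PartConnected G part i =
  (∃[ u ] part u ≡ i) ×
  (∀ u v → part u ≡ i → part v ≡ i → ∃[ ℓ ] Walk (InducedE G part i) u v ℓ)

-- Subgraphs of G: a vertex subset and an edge subset (edges read
-- symmetrically) such that every edge is an edge of G with both ends in
-- the vertex subset.

record Subgraph (n : ℕ) : Set where
  field
    vert : Fin n → Bool
    edge : Fin n → Fin n → Bool
open Subgraph public

IsSubgraphOf : ∀ {n} → Subgraph n → Adj n → Set
IsSubgraphOf H G = ∀ u v → edge H u v ≡ true → E G u v × vert H u ≡ true × vert H v ≡ true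

inHB : ∀ {n} → Subgraph n → Fin n → Fin n → Bool
inHB H u v = edge H u v ∨ edge H v u

PlusV : ∀ {n k} → (Fin n → Fin k) → Fin k → Subgraph n → Fin n → Set
PlusV part i H x = part x ≡ i ⊎ vert H x ≡ true
PlusE : ∀ {n k} → Adj n → (Fin n → Fin k) → Fin k → Subgraph n → Fin n → Fin n → Set
PlusE G part i H x y = InducedE G part i x y ⊎ inHB H x y ≡ true

DiamAtMost : ∀ {n k} → Adj n → (Fin n → Fin k) → Fin k → Subgraph n → ℚ → Set
DiamAtMost G part i H b =
  ∀ u v → PlusV part i H u → PlusV part i H v →
  ∃[ ℓ ] (Walk (PlusE G part i H) u v ℓ × (+ ℓ) / 1 ≤ℚ b)

DilationAtMost : ∀ {n k} → Adj n → (Fin n → Fin k) → (Fin k → Subgraph n) → ℚ → Set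
DilationAtMost G part H b = ∀ i → DiamAtMost G part i (H i) b

CongestionAtMost : ∀ {n k} → Adj n → (Fin k → Subgraph n) → ℚ → Set
CongestionAtMost G H b =
  ∀ u v → E G u v → (+ countTrue (λ i → inHB (H i) u v)) / 1 ≤ℚ b

ℕ→ℚ : ℕ → ℚ
ℕ→ℚ x = (+ x) / 1

{-# OPTIONS --safe #-}
-- Take a breadth-first tree of depth at most D and an integer d between δ and 3δ. From the leaves
-- up, cut a tree edge as soon as c = 8dD + 2 parts reach it from below through uncut edges. Serving
-- each part with the uncut edges it reaches costs congestion c per tree edge, and a part that reaches
-- at most 8d cut edges meets at most 8d + 1 pieces of the cut tree, each of diameter at most 2D, so
-- that its dilation is O(dD).
--
-- At least half of the parts reach at most 8d cut edges. Otherwise there are many pairs (cut edge,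
-- part reaching it), each joined by a tree path that passes at most D other parts. Sample the parts
-- with probability 1/2D: half of the pairs whose part is sampled still have a path that avoids all
-- other sampled parts. Contracting the sampled parts and, for every cut edge, the piece below it
-- minus the sampled parts turns these pairs into the edges of a minor of density more than d. The
-- sampling is made deterministic by a colouring of the parts with 2D colours in which few pairs
-- clash, each colour class being one sample.
--
-- Serving half of the remaining parts in every round takes O(log n) rounds.
module Submission where

open import Defs
open import Data.Nat hiding (_≟_)
open import Data.Nat.Properties renaming (_≟_ to _≟ℕ_)
open import Data.Nat.Logarithm using (⌈log₂_⌉; ⌈log₂⌉-mono-≤; ⌈log₂2^n⌉≡n; ⌈log₂⌈n/2⌉⌉≡⌈log₂n⌉∸1)
open import Data.Nat.Tactic.RingSolver using (solve-∀)
open import Data.Fin using (Fin; zero; suc; toℕ; punchIn; punchOut)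
open import Data.Fin.Properties
  using (_≟_; any?; punchInᵢ≢i; punchIn-injective; punchIn-punchOut; toℕ-injective; injective⇒≤)
open import Data.Bool using (Bool; true; false; _∧_; _∨_; not; if_then_else_)
open import Data.Bool.Properties using (∨-comm; ∨-zeroʳ; ∧-zeroʳ) renaming (_≟_ to _≟ᵇ_)
open import Data.Maybe using (Maybe; just; nothing)
open import Data.Maybe.Properties using (just-injective)
import Data.Maybe as Maybe
import Data.Maybe.Properties as Maybe
open import Data.Product using (Σ; ∃₂; ∃-syntax; _×_; _,_; proj₁; proj₂)
open import Data.Sum using (_⊎_; inj₁; inj₂)
import Data.Sum as Sum
import Data.Sum.Properties as Sum
open import Data.Empty using (⊥; ⊥-elim)
open import Data.List using (List; []; _∷_; length)
open import Data.List.Relation.Unary.All as All using (All; []; _∷_)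
open import Function using (_∘_; case_of_)
open import Relation.Nullary using (¬_; Dec; yes; no; contradiction)
open import Relation.Nullary.Decidable using (⌊_⌋; _×-dec_; toSum)
open import Relation.Binary.Definitions using (DecidableEquality; tri<; tri≈; tri>)
open import Relation.Binary.PropositionalEquality
open import Relation.Binary.Construct.Closure.ReflexiveTransitive using (Star; ε; _◅_; _◅◅_; reverse)
open import Algebra.Properties.Semiring.Sum +-*-semiring
  using (sum; sum-cong-≗; ∑-distrib-+; ∑-comm; *-distribˡ-sum)
open import Data.Nat.DivMod using (m≡m%n+[m/n]*n; m%n<n; m/n*n≤m)
import Data.Integer as ℤ
import Data.Integer.Properties as ℤ
open import Data.Rational as ℚ using (ℚ)
import Data.Rational.Properties as ℚ
open import Data.Rational.Unnormalised as ℚᵘ using (mkℚᵘ; *≤*)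
import Data.Rational.Unnormalised.Properties as ℚᵘ

-- Booleans, decisions and indicators

⟦_⟧ : Bool → ℕ
⟦ b ⟧ = if b then 1 else 0

⟦⟧≤1 : ∀ b → ⟦ b ⟧ ≤ 1
⟦⟧≤1 true  = ≤-refl
⟦⟧≤1 false = z≤n

⟦⟧-mono : ∀ {a b} → (a ≡ true → b ≡ true) → ⟦ a ⟧ ≤ ⟦ b ⟧
⟦⟧-mono {true}  imp = ≤-reflexive (cong ⟦_⟧ (sym (imp refl)))
⟦⟧-mono {false} imp = z≤n

∧-intro : ∀ {a b} → a ≡ true → b ≡ true → a ∧ b ≡ true
∧-intro refl refl = refl

∧-elim : ∀ {a b} → a ∧ b ≡ true → a ≡ true × b ≡ true
∧-elim {true} {true} refl = refl , refl

∨-introˡ : ∀ {a} b → a ≡ true → a ∨ b ≡ true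
∨-introˡ b refl = refl

∨-introʳ : ∀ a {b} → b ≡ true → a ∨ b ≡ true
∨-introʳ a refl = ∨-zeroʳ a

∨-elim : ∀ {a b} → a ∨ b ≡ true → a ≡ true ⊎ b ≡ true
∨-elim {true}  p = inj₁ refl
∨-elim {false} p = inj₂ p

not-true : ∀ {a} → not a ≡ true → a ≡ false
not-true {false} _ = refl

false-not : ∀ {a} → a ≡ false → not a ≡ true
false-not refl = refl

¬true⇒false : ∀ {a} → ¬ (a ≡ true) → a ≡ false
¬true⇒false {true}  p = ⊥-elim (p refl)
¬true⇒false {false} p = refl

if-true : ∀ {A : Set} {b} {x y : A} → b ≡ true → (if b then x else y) ≡ x
if-true refl = refl

if-false : ∀ {A : Set} {b} {x y : A} → b ≡ false → (if b then x else y) ≡ y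
if-false refl = refl

true≢false : ∀ {a} → a ≡ true → a ≡ false → ⊥
true≢false refl ()

⌊⌋-elim : ∀ {P : Set} (d : Dec P) → ⌊ d ⌋ ≡ true → P
⌊⌋-elim (yes p) _ = p

⌊⌋-intro : ∀ {P : Set} (d : Dec P) → P → ⌊ d ⌋ ≡ true
⌊⌋-intro (yes _) p = refl
⌊⌋-intro (no ¬p) p = contradiction p ¬p

⌊⌋-intro-¬ : ∀ {P : Set} (d : Dec P) → ¬ P → ⌊ d ⌋ ≡ false
⌊⌋-intro-¬ (yes p) ¬p = contradiction p ¬p
⌊⌋-intro-¬ (no _)  ¬p = refl

eqB-elim : ∀ {n} {u v : Fin n} → eqB u v ≡ true → u ≡ v
eqB-elim {u = u} {v} = ⌊⌋-elim (u ≟ v)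

eqB-intro : ∀ {n} {u v : Fin n} → u ≡ v → eqB u v ≡ true
eqB-intro {u = u} {v} = ⌊⌋-intro (u ≟ v)

eqB-intro-¬ : ∀ {n} {u v : Fin n} → u ≢ v → eqB u v ≡ false
eqB-intro-¬ {u = u} {v} = ⌊⌋-intro-¬ (u ≟ v)

-- Sums over Fin

sum-mono : ∀ {n} {f g : Fin n → ℕ} → (∀ i → f i ≤ g i) → sum f ≤ sum g
sum-mono {zero}  h = z≤n
sum-mono {suc n} h = +-mono-≤ (h zero) (sum-mono (h ∘ suc))

sum-const : ∀ n c → sum {n} (λ _ → c) ≡ n * c
sum-const zero    c = refl
sum-const (suc n) c = cong (c +_) (sum-const n c)

sum-zero : ∀ {n} (f : Fin n → ℕ) → (∀ i → f i ≡ 0) → sum f ≡ 0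
sum-zero {n} f h = trans (sum-cong-≗ h) (trans (sum-const n 0) (*-zeroʳ n))

term≤sum : ∀ {n} (f : Fin n → ℕ) i → f i ≤ sum f
term≤sum f zero    = m≤m+n _ _
term≤sum f (suc i) = ≤-trans (term≤sum (f ∘ suc) i) (m≤n+m _ _)

sum-+-≤ : ∀ {n} {f g h : Fin n → ℕ} → (∀ i → f i ≤ g i + h i) → sum f ≤ sum g + sum h
sum-+-≤ {f = f} {g} {h} p = ≤-trans (sum-mono p) (≤-reflexive (∑-distrib-+ g h))

∑∑ : ∀ {m n} → (Fin m → Fin n → ℕ) → ℕ
∑∑ f = sum (λ i → sum (f i))

∑∑-mono : ∀ {m n} {f g : Fin m → Fin n → ℕ} → (∀ i j → f i j ≤ g i j) → ∑∑ f ≤ ∑∑ g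
∑∑-mono h = sum-mono (λ i → sum-mono (h i))

∑∑-cong : ∀ {m n} {f g : Fin m → Fin n → ℕ} → (∀ i j → f i j ≡ g i j) → ∑∑ f ≡ ∑∑ g
∑∑-cong h = sum-cong-≗ (λ i → sum-cong-≗ (h i))

∑∑-+ : ∀ {m n} (f g : Fin m → Fin n → ℕ) → ∑∑ (λ i j → f i j + g i j) ≡ ∑∑ f + ∑∑ g
∑∑-+ f g = trans (sum-cong-≗ (λ i → ∑-distrib-+ (f i) (g i))) (∑-distrib-+ (sum ∘ f) (sum ∘ g))

∑∑-* : ∀ {m n} c (f : Fin m → Fin n → ℕ) → c * ∑∑ f ≡ ∑∑ (λ i j → c * f i j)
∑∑-* c f = trans (*-distribˡ-sum c (sum ∘ f)) (sum-cong-≗ (λ i → *-distribˡ-sum c (f i)))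

sum-∑∑-comm : ∀ {l m n} (f : Fin l → Fin m → Fin n → ℕ) →
              sum (λ c → ∑∑ (f c)) ≡ ∑∑ (λ i j → sum (λ c → f c i j))
sum-∑∑-comm f = trans (∑-comm (λ c i → sum (f c i))) (sum-cong-≗ (λ i → ∑-comm (λ c j → f c i j)))

∑∑-∑∑-comm : ∀ {k l m n} (f : Fin k → Fin l → Fin m → Fin n → ℕ) →
             ∑∑ (λ a b → ∑∑ (f a b)) ≡ ∑∑ (λ i j → ∑∑ (λ a b → f a b i j))
∑∑-∑∑-comm f = trans (sum-cong-≗ (λ a → sum-∑∑-comm (f a))) (sum-∑∑-comm (λ a i j → sum (λ b → f a b i j)))

countTrue-sum : ∀ {n} (f : Fin n → Bool) → countTrue f ≡ sum (λ i → ⟦ f i ⟧)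
countTrue-sum {zero}  f = refl
countTrue-sum {suc n} f = cong (⟦ f zero ⟧ +_) (countTrue-sum (f ∘ suc))

countTrue-mono : ∀ {n} {f g : Fin n → Bool} → (∀ i → f i ≡ true → g i ≡ true) → countTrue f ≤ countTrue g
countTrue-mono {f = f} {g} h =
  subst₂ _≤_ (sym (countTrue-sum f)) (sym (countTrue-sum g)) (sum-mono (λ i → ⟦⟧-mono (h i)))

countTrue-∪ : ∀ {n} {f g h : Fin n → Bool} → (∀ i → f i ≡ true → g i ≡ true ⊎ h i ≡ true) →
              countTrue f ≤ countTrue g + countTrue h
countTrue-∪ {f = f} {g} {h} p =
  subst₂ _≤_ (sym (countTrue-sum f)) (sym (cong₂ _+_ (countTrue-sum g) (countTrue-sum h))) (sum-+-≤ ind)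
  where
  ind : ∀ i → ⟦ f i ⟧ ≤ ⟦ g i ⟧ + ⟦ h i ⟧
  ind i with f i in eq
  ... | false = z≤n
  ... | true with p i eq
  ...   | inj₁ q = ≤-trans (≤-reflexive (cong ⟦_⟧ (sym q))) (m≤m+n _ _)
  ...   | inj₂ q = ≤-trans (≤-reflexive (cong ⟦_⟧ (sym q))) (m≤n+m _ _)

countTrue-none : ∀ {n} {f : Fin n → Bool} → (∀ i → f i ≡ false) → countTrue f ≡ 0
countTrue-none {f = f} h = trans (countTrue-sum f) (sum-zero _ (λ i → cong ⟦_⟧ (h i)))

countTrue-any : ∀ {n} {f : Fin n → Bool} i → f i ≡ true → 1 ≤ countTrue f
countTrue-any {f = f} i p =
  subst₂ _≤_ (cong ⟦_⟧ p) (sym (countTrue-sum f)) (term≤sum (λ j → ⟦ f j ⟧) i)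

countTrue≤n : ∀ {n} (f : Fin n → Bool) → countTrue f ≤ n
countTrue≤n {n} f = subst₂ _≤_ (sym (countTrue-sum f)) (trans (sum-const n 1) (*-identityʳ n))
  (sum-mono (λ i → ⟦⟧≤1 (f i)))

countTrue-split : ∀ {n} (f g : Fin n → Bool) →
                  countTrue f ≡ countTrue (λ i → f i ∧ g i) + countTrue (λ i → f i ∧ not (g i))
countTrue-split f g = begin
  countTrue f                                       ≡⟨ countTrue-sum f ⟩
  sum (λ i → ⟦ f i ⟧)                               ≡⟨ sum-cong-≗ (λ i → split (f i) (g i)) ⟩
  sum (λ i → ⟦ f i ∧ g i ⟧ + ⟦ f i ∧ not (g i) ⟧)   ≡⟨ ∑-distrib-+ (λ i → ⟦ f i ∧ g i ⟧) _ ⟩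
  sum (λ i → ⟦ f i ∧ g i ⟧) + sum (λ i → ⟦ f i ∧ not (g i) ⟧)
    ≡⟨ cong₂ _+_ (countTrue-sum (λ i → f i ∧ g i)) (countTrue-sum (λ i → f i ∧ not (g i))) ⟨
  countTrue (λ i → f i ∧ g i) + countTrue (λ i → f i ∧ not (g i)) ∎
  where
  open ≡-Reasoning
  split : ∀ a b → ⟦ a ⟧ ≡ ⟦ a ∧ b ⟧ + ⟦ a ∧ not b ⟧
  split true  true  = refl
  split true  false = refl
  split false _     = refl

countTrue-unique : ∀ {n} {f : Fin n → Bool} → (∀ i j → f i ≡ true → f j ≡ true → i ≡ j) → countTrue f ≤ 1
countTrue-unique {zero}  h = z≤n
countTrue-unique {suc n} {f} h with f zero in eq
... | true  = s≤s (≤-reflexive (countTrue-none (λ i → ¬true⇒false λ p → case h zero (suc i) eq p of λ ())))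
... | false = countTrue-unique (λ i j p q → suc-inj (h (suc i) (suc j) p q))
  where
  suc-inj : ∀ {m} {i j : Fin m} → Fin.suc i ≡ suc j → i ≡ j
  suc-inj refl = refl

sum-δ : ∀ {n} (a : Fin n) x → sum (λ c → ⟦ eqB a c ⟧ * x) ≡ x
sum-δ {suc n} zero x =
  trans (cong₂ _+_ (+-identityʳ x) (sum-zero {n} _ λ i → cong (λ b → ⟦ b ⟧ * x) (eqB-intro-¬ {u = zero} {suc i} λ ())))
        (+-identityʳ x)
sum-δ {suc n} (suc a) x = trans
  (cong₂ _+_ (cong (λ b → ⟦ b ⟧ * x) (eqB-intro-¬ {u = suc a} {zero} λ ()))
    (sum-cong-≗ (λ c → cong (λ b → ⟦ b ⟧ * x) (eqB-suc a c))))
  (sum-δ a x)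
  where
  eqB-suc : ∀ {m} (i j : Fin m) → eqB (Fin.suc i) (suc j) ≡ eqB i j
  eqB-suc i j with i ≟ j
  ... | yes _ = refl
  ... | no  _ = refl

-- The summation function of numEdges is local to its definition; the meta-variable is solved
-- to that function by the proof of numEdges-suc, which makes it accessible.
mutual
  sumRows : ∀ {N} → Adj N → ∀ {m} → (Fin m → ℕ) → ℕ
  sumRows = _

  numEdges-suc : ∀ {n} (G : Adj (suc n)) →
    numEdges G ≡ countTrue (λ v → ⌊ 0 <? toℕ v ⌋ ∧ edgeB G zero v)
               + sumRows G (λ i → countTrue (λ v → ⌊ suc (toℕ i) <? toℕ v ⌋ ∧ edgeB G (suc i) v))
  numEdges-suc {n} G
    with countTrue (λ v → ⌊ 0 <? toℕ v ⌋ ∧ edgeB G zero v)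
       | (λ (i : Fin n) → countTrue (λ v → ⌊ suc (toℕ i) <? toℕ v ⌋ ∧ edgeB G (suc i) v))
  ... | x | f with suc n
  ... | N = refl

sumRows≡sum : ∀ {N} (G : Adj N) {m} (f : Fin m → ℕ) → sumRows G f ≡ sum f
sumRows≡sum G {zero}  f = refl
sumRows≡sum G {suc m} f = cong (f zero +_) (sumRows≡sum G (f ∘ suc))

numEdges≡∑∑ : ∀ {n} (G : Adj n) → numEdges G ≡ ∑∑ (λ u v → ⟦ ⌊ toℕ u <? toℕ v ⌋ ∧ edgeB G u v ⟧)
numEdges≡∑∑ {zero}  G = refl
numEdges≡∑∑ {suc n} G = trans
  (sumRows≡sum G (λ u → countTrue (λ v → ⌊ toℕ u <? toℕ v ⌋ ∧ edgeB G u v)))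
  (sum-cong-≗ {suc n} (λ u → countTrue-sum (λ v → ⌊ toℕ u <? toℕ v ⌋ ∧ edgeB G u v)))

-- Colourings with few monochromatic pairs

argmin : ∀ {n} (g : Fin (suc n) → ℕ) → ∃[ c ] (∀ c′ → g c ≤ g c′)
argmin {zero}  g = zero , λ { zero → ≤-refl }
argmin {suc n} g with argmin (g ∘ suc)
... | c , h with ≤-total (g zero) (g (suc c))
...   | inj₁ p = zero  , λ { zero → ≤-refl ; (suc c′) → ≤-trans p (h c′) }
...   | inj₂ p = suc c , λ { zero → p ; (suc c′) → h c′ }

below-average : ∀ {n} (g : Fin (suc n) → ℕ) → ∃[ c ] suc n * g c ≤ sum g
below-average {n} g with argmin g
... | c , h = c , ≤-trans (≤-reflexive (sym (sum-const (suc n) (g c)))) (sum-mono h)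

eqB-sym : ∀ {n} (a b : Fin n) → eqB a b ≡ eqB b a
eqB-sym a b with a ≟ b
... | yes p = sym (eqB-intro (sym p))
... | no ¬p = sym (eqB-intro-¬ (¬p ∘ sym))

∑∑-suc : ∀ {k} (h : Fin (suc k) → Fin (suc k) → ℕ) →
         ∑∑ h ≡ h zero zero + (sum (λ j → h zero (suc j) + h (suc j) zero) + ∑∑ (λ i j → h (suc i) (suc j)))
∑∑-suc h = begin
  (a + b) + sum (λ i → h (suc i) zero + sum (λ j → h (suc i) (suc j)))
    ≡⟨ cong ((a + b) +_) (∑-distrib-+ (λ i → h (suc i) zero) _) ⟩
  (a + b) + (c + d)                                      ≡⟨ rearrange a b c d ⟩
  a + ((b + c) + d)
    ≡⟨ cong (λ x → a + (x + d)) (∑-distrib-+ (λ j → h zero (suc j)) (λ j → h (suc j) zero)) ⟨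
  a + (sum (λ j → h zero (suc j) + h (suc j) zero) + d)  ∎
  where
  open ≡-Reasoning
  a = h zero zero
  b = sum (λ j → h zero (suc j))
  c = sum (λ i → h (suc i) zero)
  d = ∑∑ (λ i j → h (suc i) (suc j))
  rearrange : ∀ a b c d → (a + b) + (c + d) ≡ a + ((b + c) + d)
  rearrange = solve-∀

-- Greedy: each new element takes the colour of least conflict with the elements coloured before.
colouring : ∀ q {k} (w : Fin k → Fin k → ℕ) → (∀ i → w i i ≡ 0) →
            Σ (Fin k → Fin (suc q)) λ f → suc q * ∑∑ (λ i j → ⟦ eqB (f i) (f j) ⟧ * w i j) ≤ ∑∑ w
colouring q {zero}  w w-diag = (λ ()) , ≤-reflexive (*-zeroʳ q)
colouring q {suc k} w w-diag
  with colouring q (λ i j → w (suc i) (suc j)) (λ i → w-diag (suc i))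
... | f , f-few
  with below-average (λ c → sum (λ j → ⟦ eqB (f j) c ⟧ * (w zero (suc j) + w (suc j) zero)))
... | c , c-few = f⁺ , bound
  where
  open ≤-Reasoning
  f⁺ : Fin (suc k) → Fin (suc q)
  f⁺ zero    = c
  f⁺ (suc i) = f i

  w₀ : Fin k → ℕ
  w₀ j = w zero (suc j) + w (suc j) zero

  mono : Fin (suc k) → Fin (suc k) → ℕ
  mono i j = ⟦ eqB (f⁺ i) (f⁺ j) ⟧ * w i j

  -- Each earlier element conflicts with exactly one choice of colour, so the costs of all colours
  -- sum to the total weight `w₀`, and the cheapest colour is at most the average.
  total : sum (λ c → sum (λ j → ⟦ eqB (f j) c ⟧ * w₀ j)) ≡ sum w₀
  total = trans (∑-comm (λ c j → ⟦ eqB (f j) c ⟧ * w₀ j)) (sum-cong-≗ (λ j → sum-δ (f j) (w₀ j)))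

  mono-zero : ∀ j → mono zero (suc j) + mono (suc j) zero ≡ ⟦ eqB (f j) c ⟧ * w₀ j
  mono-zero j = trans
    (cong (λ b → ⟦ b ⟧ * w zero (suc j) + mono (suc j) zero) (eqB-sym c (f j)))
    (sym (*-distribˡ-+ ⟦ eqB (f j) c ⟧ (w zero (suc j)) (w (suc j) zero)))

  cost rest : ℕ
  cost = sum (λ j → ⟦ eqB (f j) c ⟧ * w₀ j)
  rest = ∑∑ (λ i j → mono (suc i) (suc j))

  bound : suc q * ∑∑ mono ≤ ∑∑ w
  bound = begin
    suc q * ∑∑ mono
      ≡⟨ cong (suc q *_) (∑∑-suc mono) ⟩
    suc q * (mono zero zero + (sum (λ j → mono zero (suc j) + mono (suc j) zero) + rest))
      ≡⟨ cong₂ (λ x y → suc q * (x + (y + rest)))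
           (trans (cong (⟦ eqB c c ⟧ *_) (w-diag zero)) (*-zeroʳ ⟦ eqB c c ⟧)) (sum-cong-≗ mono-zero) ⟩
    suc q * (cost + rest)
      ≡⟨ *-distribˡ-+ (suc q) cost rest ⟩
    suc q * cost + suc q * rest
      ≤⟨ +-mono-≤ (≤-trans c-few (≤-reflexive total)) f-few ⟩
    sum w₀ + ∑∑ (λ i j → w (suc i) (suc j))
      ≤⟨ m≤n+m _ (w zero zero) ⟩
    w zero zero + (sum w₀ + ∑∑ (λ i j → w (suc i) (suc j)))
      ≡⟨ ∑∑-suc w ⟨
    ∑∑ w ∎

-- Minors from branch sets

E-intro : ∀ {n} {G : Adj n} {u v} → u ≢ v → G u v ≡ true ⊎ G v u ≡ true → E G u v
E-intro {G = G} {u} {v} u≢v uv = ∧-intro (cong not (eqB-intro-¬ u≢v)) (either uv)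
  where
  either : G u v ≡ true ⊎ G v u ≡ true → G u v ∨ G v u ≡ true
  either (inj₁ p) = ∨-introˡ (G v u) p
  either (inj₂ p) = ∨-introʳ (G u v) p

E-irrefl : ∀ {n} {G : Adj n} {u v} → E G u v → u ≢ v
E-irrefl e u≡v = true≢false (eqB-intro u≡v) (not-true (proj₁ (∧-elim e)))

E-elim-∨ : ∀ {n} {G : Adj n} {u v} → E G u v → G u v ∨ G v u ≡ true
E-elim-∨ {G = G} {u} {v} e = proj₂ (∧-elim {distinctB u v} e)

E-elim : ∀ {n} {G : Adj n} {u v} → E G u v → G u v ≡ true ⊎ G v u ≡ true
E-elim {G = G} e = ∨-elim (E-elim-∨ {G = G} e)

E-sym : ∀ {n} {G : Adj n} {u v} → E G u v → E G v u
E-sym {G = G} {u} {v} e = E-intro {G = G} (E-irrefl {G = G} e ∘ sym) (swap (E-elim {G = G} e))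
  where
  swap : ∀ {A B : Set} → A ⊎ B → B ⊎ A
  swap (inj₁ a) = inj₂ a
  swap (inj₂ b) = inj₁ b

module _ {L : Set} where

  Same : ∀ {N} → Adj N → (Fin N → Maybe L) → Fin N → Fin N → Set
  Same G β x y = E G x y × β x ≡ β y

  -- The label `nothing` marks the vertices to be deleted, so connectivity is asked only of the
  -- preimages of `just a`.
  BranchSets : ∀ {N} → Adj N → (Fin N → Maybe L) → Set
  BranchSets G β = ∀ {x y a} → β x ≡ just a → β y ≡ just a → Star (Same G β) x y

  -- The vertices of the minor are known only through their labels. This suffices to count its
  -- vertices and edges and spares following the renumbering by deletions and contractions.
  record BranchMinor {N} (G : Adj N) (β : Fin N → Maybe L) : Set where
    field
      {size}          : ℕ
      {graph}         : Adj size
      minor           : Minor graph G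
      label           : Fin size → L
      label-injective : ∀ {x y} → label x ≡ label y → x ≡ y
      label-source    : ∀ x → ∃[ y ] β y ≡ just (label x)
      label-edge      : ∀ {x y a b} → E G x y → β x ≡ just a → β y ≡ just b → a ≢ b →
                        ∃₂ λ x′ y′ → label x′ ≡ a × label y′ ≡ b × E graph x′ y′

  -- Base case of `branchMinor`: a step inside a branch set would contradict `proper`, so branch
  -- sets are single vertices and the graph itself is the minor.
  irreducible : ∀ {N} (G : Adj N) (β : Fin N → Maybe L) → BranchSets G β →
                (∀ x → β x ≢ nothing) → (∀ {x y} → E G x y → β x ≢ β y) → BranchMinor G β
  irreducible {N} G β conn total proper = record
    { minor           = done
    ; label           = label
    ; label-injective = injective
    ; label-source    = λ x → x , label-just x
    ; label-edge      = λ {x} {y} e p q _ → x , y , just-injective (trans (sym (label-just x)) p)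
                                              , just-injective (trans (sym (label-just y)) q) , e
    }
    where
    labelled : ∀ x → ∃[ a ] β x ≡ just a
    labelled x with β x in eq
    ... | just a  = a , refl
    ... | nothing = contradiction eq (total x)

    label : Fin N → L
    label x = proj₁ (labelled x)

    label-just : ∀ x → β x ≡ just (label x)
    label-just x = proj₂ (labelled x)

    trivial : ∀ {x y} → Star (Same G β) x y → x ≡ y
    trivial ε             = refl
    trivial ((e , p) ◅ _) = contradiction p (proper e)

    injective : ∀ {x y} → label x ≡ label y → x ≡ y
    injective {x} {y} p = trivial (conn (trans (label-just x) (cong just p)) (label-just y))

  module _ {N} (G : Adj (suc N)) (β : Fin (suc N) → Maybe L) (v : Fin (suc N)) where

    removeV-edge : ∀ {x y} → E G (punchIn v x) (punchIn v y) → E (removeV G v) x y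
    removeV-edge {x} {y} e =
      E-intro {G = removeV G v} (E-irrefl {G = G} e ∘ cong (punchIn v)) (E-elim {G = G} e)

    module _ (βv : β v ≡ nothing) where

      labelled≢v : ∀ {z a} → β z ≡ just a → v ≢ z
      labelled≢v p refl = case trans (sym βv) p of λ ()

      -- Labels are constant along the path, so it never meets the unlabelled `v`. The endpoints
      -- enter through equations to permit induction on the path in `G`.
      removeV-star : ∀ {a b l x y} → β a ≡ just l → Star (Same G β) a b → punchIn v x ≡ a → punchIn v y ≡ b →
                     Star (Same (removeV G v) (β ∘ punchIn v)) x y
      removeV-star {x = x} {y} p ε refl q with punchIn-injective v y x q
      ... | refl = ε
      removeV-star p (_◅_ {j = c} (e , s) w) refl q =
        (removeV-edge (subst (E G _) (sym c≡) e) , trans s (cong β (sym c≡))) ◅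
        removeV-star (trans (sym s) p) w c≡ q
        where
        c≡ : punchIn v (punchOut (labelled≢v (trans (sym s) p))) ≡ c
        c≡ = punchIn-punchOut _

      delete : BranchMinor (removeV G v) (β ∘ punchIn v) → BranchMinor G β
      delete M = record
        { minor           = delV v minor
        ; label           = label
        ; label-injective = label-injective
        ; label-source    = λ x → punchIn v (proj₁ (label-source x)) , proj₂ (label-source x)
        ; label-edge      = keeps
        }
        where
        open BranchMinor M
        keeps : ∀ {x y a b} → E G x y → β x ≡ just a → β y ≡ just b → a ≢ b →
               ∃₂ λ x′ y′ → label x′ ≡ a × label y′ ≡ b × E graph x′ y′
        keeps e p q a≢b = label-edge
          (removeV-edge (subst₂ (E G) (sym (punchIn-punchOut (labelled≢v p))) (sym (punchIn-punchOut (labelled≢v q))) e))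
          (trans (cong β (punchIn-punchOut _)) p) (trans (cong β (punchIn-punchOut _)) q) a≢b

    module _ (u : Fin (suc N)) (uv : E G u v) (βuv : β u ≡ β v) where

      v≢u : v ≢ u
      v≢u = E-irrefl {G = G} uv ∘ sym

      merge : Fin (suc N) → Fin N
      merge z with v ≟ z
      ... | yes _  = punchOut v≢u
      ... | no v≢z = punchOut v≢z

      merge-rep : ∀ z → (v ≢ z × punchIn v (merge z) ≡ z) ⊎ (v ≡ z × punchIn v (merge z) ≡ u)
      merge-rep z with v ≟ z
      ... | yes v≡z = inj₂ (v≡z , punchIn-punchOut v≢u)
      ... | no v≢z  = inj₁ (v≢z , punchIn-punchOut v≢z)

      merge-label : ∀ z → β (punchIn v (merge z)) ≡ β z
      merge-label z with merge-rep z
      ... | inj₁ (_ , p)    = cong β p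
      ... | inj₂ (refl , p) = trans (cong β p) βuv

      merge-punchIn : ∀ x → merge (punchIn v x) ≡ x
      merge-punchIn x with merge-rep (punchIn v x)
      ... | inj₁ (_ , p) = punchIn-injective v _ _ p
      ... | inj₂ (p , _) = contradiction (sym p) (punchInᵢ≢i v x)

      -- contract G u v x y is mergedB (punchIn v x) (punchIn v y)
      mergedB : Fin (suc N) → Fin (suc N) → Bool
      mergedB x y = G x y ∨ ((eqB x u ∧ (G v y ∨ G y v)) ∨ (eqB y u ∧ (G x v ∨ G v x)))

      merged : ∀ a b → E G a b → mergedB (punchIn v (merge a)) (punchIn v (merge b)) ≡ true
                               ⊎ mergedB (punchIn v (merge b)) (punchIn v (merge a)) ≡ true
      merged a b e with merge-rep a | merge-rep b
      ... | inj₁ (_ , p) | inj₁ (_ , q) rewrite p | q with E-elim {G = G} e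
      ...   | inj₁ g = inj₁ (∨-introˡ _ g)
      ...   | inj₂ g = inj₂ (∨-introˡ _ g)
      merged a b e | inj₂ (refl , p) | inj₁ (_ , q) rewrite p | q =
        inj₁ (∨-introʳ (G u b) (∨-introˡ _ (∧-intro (eqB-intro {u = u} refl) (E-elim-∨ {G = G} e))))
      merged a b e | inj₁ (_ , p) | inj₂ (refl , q) rewrite p | q =
        inj₁ (∨-introʳ (G a u) (∨-introʳ (eqB a u ∧ _) (∧-intro (eqB-intro {u = u} refl) (E-elim-∨ {G = G} e))))
      merged a b e | inj₂ (refl , _) | inj₂ (refl , _) = contradiction refl (E-irrefl {G = G} e)

      contract-edge : ∀ {a b} → E G a b → merge a ≡ merge b ⊎ E (contract G u v) (merge a) (merge b)
      contract-edge {a} {b} e = Sum.map₂ (λ ¬p → E-intro {G = contract G u v} ¬p (merged a b e)) (toSum (merge a ≟ merge b))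

      contract-star : ∀ {a b} → Star (Same G β) a b →
                      Star (Same (contract G u v) (β ∘ punchIn v)) (merge a) (merge b)
      contract-star ε = ε
      contract-star {a} (_◅_ {j = c} (e , s) w) with contract-edge e
      ... | inj₁ p  = subst (λ z → Star _ z _) (sym p) (contract-star w)
      ... | inj₂ e′ = (e′ , trans (merge-label a) (trans s (sym (merge-label c)))) ◅ contract-star w

      contractMinor : BranchMinor (contract G u v) (β ∘ punchIn v) → BranchMinor G β
      contractMinor M = record
        { minor           = contrE u v uv minor
        ; label           = label
        ; label-injective = label-injective
        ; label-source    = λ x → punchIn v (proj₁ (label-source x)) , proj₂ (label-source x)
        ; label-edge      = keeps
        }
        where
        open BranchMinor M
        keeps : ∀ {x y a b} → E G x y → β x ≡ just a → β y ≡ just b → a ≢ b →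
               ∃₂ λ x′ y′ → label x′ ≡ a × label y′ ≡ b × E graph x′ y′
        keeps {x} {y} e p q a≢b with contract-edge e
        ... | inj₂ e′ = label-edge e′ (trans (merge-label x) p) (trans (merge-label y) q) a≢b
        -- `merge` preserves labels, so an edge between different labels cannot collapse.
        ... | inj₁ r  = contradiction
          (just-injective (trans (sym (trans (merge-label x) p)) (trans (cong (β ∘ punchIn v) r) (trans (merge-label y) q))))
          a≢b

  -- Induction on the number of vertices: an unlabelled vertex is deleted; if there is none, an edge
  -- inside a branch set is contracted; if there is none either, `irreducible` applies.
  branchMinor : DecidableEquality L → ∀ {N} (G : Adj N) (β : Fin N → Maybe L) → BranchSets G β → BranchMinor G β
  branchMinor _≟L_ {zero}  G β conn = irreducible G β conn (λ ()) (λ { {()} })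
  branchMinor _≟L_ {suc N} G β conn with any? (λ x → Maybe.≡-dec _≟L_ (β x) nothing)
  ... | yes (v , βv) = delete G β v βv (branchMinor _≟L_ (removeV G v) (β ∘ punchIn v)
                         (λ p q → removeV-star G β v βv p (conn p q) refl refl))
  ... | no total with any? (λ u → any? (λ v → edgeB G u v ≟ᵇ true ×-dec Maybe.≡-dec _≟L_ (β u) (β v)))
  ...   | yes (u , v , uv , βuv) = contractMinor G β v u uv βuv (branchMinor _≟L_ (contract G u v) (β ∘ punchIn v)
                         (λ {x} {y} p q → subst₂ (Star _) (merge-punchIn G β v u uv βuv x) (merge-punchIn G β v u uv βuv y)
                                  (contract-star G β v u uv βuv (conn p q))))
  ...   | no proper = irreducible G β conn (λ x p → total (x , p)) (λ {x} {y} e p → proper (x , y , e , p))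

-- Bipartite minors and their edge counts

sum-unique : ∀ {n} {f : Fin n → Bool} {p} → (∀ x y → f x ≡ true → f y ≡ true → x ≡ y) →
             (∀ x → f x ≡ true → p ≡ true) → sum (λ x → ⟦ f x ⟧) ≤ ⟦ p ⟧
sum-unique {f = f} {true}  uniq imp = subst (_≤ 1) (countTrue-sum f) (countTrue-unique uniq)
sum-unique {f = f} {false} uniq imp =
  ≤-reflexive (sum-zero _ (λ x → cong ⟦_⟧ (¬true⇒false λ p → case imp x p of λ ())))

-- `numEdges` counts an edge at its increasing orientation. As `r` contains at most one orientation
-- of each edge, turning its decreasing pairs around creates no double count.
oriented≤numEdges : ∀ {n} (G : Adj n) (r : Fin n → Fin n → Bool) → (∀ x y → r x y ≡ true → E G x y) →
                    (∀ x y → r x y ≡ true → r y x ≡ true → ⊥) → ∑∑ (λ x y → ⟦ r x y ⟧) ≤ numEdges G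
oriented≤numEdges {n} G r r⇒E anti = begin
  ∑∑ (λ x y → ⟦ r x y ⟧)
    ≤⟨ ∑∑-mono ordered ⟩
  ∑∑ (λ x y → ⟦ x ≺ y ∧ r x y ⟧ + ⟦ y ≺ x ∧ r x y ⟧)
    ≡⟨ ∑∑-+ (λ x y → ⟦ x ≺ y ∧ r x y ⟧) (λ x y → ⟦ y ≺ x ∧ r x y ⟧) ⟩
  ∑∑ (λ x y → ⟦ x ≺ y ∧ r x y ⟧) + ∑∑ (λ x y → ⟦ y ≺ x ∧ r x y ⟧)
    ≡⟨ cong (∑∑ (λ x y → ⟦ x ≺ y ∧ r x y ⟧) +_) (∑-comm (λ x y → ⟦ y ≺ x ∧ r x y ⟧)) ⟩
  ∑∑ (λ x y → ⟦ x ≺ y ∧ r x y ⟧) + ∑∑ (λ x y → ⟦ x ≺ y ∧ r y x ⟧)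
    ≡⟨ ∑∑-+ (λ x y → ⟦ x ≺ y ∧ r x y ⟧) (λ x y → ⟦ x ≺ y ∧ r y x ⟧) ⟨
  ∑∑ (λ x y → ⟦ x ≺ y ∧ r x y ⟧ + ⟦ x ≺ y ∧ r y x ⟧)
    ≤⟨ ∑∑-mono merge-orders ⟩
  ∑∑ (λ x y → ⟦ x ≺ y ∧ edgeB G x y ⟧)
    ≡⟨ numEdges≡∑∑ G ⟨
  numEdges G ∎
  where
  open ≤-Reasoning
  _≺_ : Fin n → Fin n → Bool
  x ≺ y = ⌊ toℕ x <? toℕ y ⌋

  ordered : ∀ x y → ⟦ r x y ⟧ ≤ ⟦ x ≺ y ∧ r x y ⟧ + ⟦ y ≺ x ∧ r x y ⟧
  ordered x y with r x y in rxy
  ... | false = z≤n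
  ... | true with <-cmp (toℕ x) (toℕ y)
  ...   | tri< lt _ _ rewrite ⌊⌋-intro (toℕ x <? toℕ y) lt = s≤s z≤n
  ...   | tri≈ _ eq _ = contradiction (toℕ-injective eq) (E-irrefl {G = G} (r⇒E x y rxy))
  ...   | tri> _ _ gt rewrite ⌊⌋-intro (toℕ y <? toℕ x) gt = m≤n+m 1 _

  merge-orders : ∀ x y → ⟦ x ≺ y ∧ r x y ⟧ + ⟦ x ≺ y ∧ r y x ⟧ ≤ ⟦ x ≺ y ∧ edgeB G x y ⟧
  merge-orders x y with x ≺ y
  ... | false = z≤n
  ... | true with r x y in rxy | r y x in ryx
  ...   | false | false = z≤n
  ...   | true  | false = ≤-reflexive (cong ⟦_⟧ (sym (r⇒E x y rxy)))
  ...   | false | true  = ≤-reflexive (cong ⟦_⟧ (sym (E-sym {G = G} (r⇒E y x ryx))))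
  ...   | true  | true  = ⊥-elim (anti x y rxy ryx)

-- Turns a labelling into numbers for the density bound: distinct vertices of the minor have
-- distinct labels, all from `P` or `Q`, and distinct pairs in `g` give distinct edges.
bipartiteMinor :
  ∀ {N a b} (G : Adj N) (β : Fin N → Maybe (Fin a ⊎ Fin b)) → BranchSets G β →
  (P : Fin a → Bool) → (∀ x {u} → β x ≡ just (inj₁ u) → P u ≡ true) →
  (Q : Fin b → Bool) → (∀ x {i} → β x ≡ just (inj₂ i) → Q i ≡ true) →
  (g : Fin a → Fin b → Bool) →
  (∀ u i → g u i ≡ true → ∃₂ λ x y → E G x y × β x ≡ just (inj₁ u) × β y ≡ just (inj₂ i)) →
  ∃[ m ] Σ (Adj m) λ H → Minor H G × m ≤ countTrue P + countTrue Q × ∑∑ (λ u i → ⟦ g u i ⟧) ≤ numEdges H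
bipartiteMinor {N} {a} {b} G β conn P βP Q βQ g g-edge = size , graph , minor , size-bound , edge-bound
  where
  _≟L_ : DecidableEquality (Fin a ⊎ Fin b)
  _≟L_ = Sum.≡-dec _≟_ _≟_

  open BranchMinor (branchMinor _≟L_ G β conn)
  open ≤-Reasoning

  isˡ : Fin size → Fin a → Bool
  isˡ x u = ⌊ label x ≟L inj₁ u ⌋

  isʳ : Fin size → Fin b → Bool
  isʳ x i = ⌊ label x ≟L inj₂ i ⌋

  isˡ-elim : ∀ x u → isˡ x u ≡ true → label x ≡ inj₁ u
  isˡ-elim x u = ⌊⌋-elim (label x ≟L inj₁ u)

  isʳ-elim : ∀ x i → isʳ x i ≡ true → label x ≡ inj₂ i
  isʳ-elim x i = ⌊⌋-elim (label x ≟L inj₂ i)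

  labelled : ∀ x → 1 ≤ sum (λ u → ⟦ isˡ x u ∧ P u ⟧) + sum (λ i → ⟦ isʳ x i ∧ Q i ⟧)
  labelled x with label x in eq | label-source x
  ... | inj₁ u | y , βy = ≤-trans
    (≤-trans (≤-reflexive (cong ⟦_⟧ (sym (∧-intro (⌊⌋-intro (inj₁ u ≟L inj₁ u) refl) (βP y βy)))))
             (term≤sum (λ u′ → ⟦ ⌊ inj₁ u ≟L inj₁ u′ ⌋ ∧ P u′ ⟧) u))
    (m≤m+n _ _)
  ... | inj₂ i | y , βy = ≤-trans
    (≤-trans (≤-reflexive (cong ⟦_⟧ (sym (∧-intro (⌊⌋-intro (inj₂ i ≟L inj₂ i) refl) (βQ y βy)))))
             (term≤sum (λ i′ → ⟦ ⌊ inj₂ i ≟L inj₂ i′ ⌋ ∧ Q i′ ⟧) i))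
    (m≤n+m _ _)

  size-bound : size ≤ countTrue P + countTrue Q
  size-bound = begin
    size
      ≡⟨ trans (sum-const size 1) (*-identityʳ size) ⟨
    sum {size} (λ _ → 1)
      ≤⟨ sum-+-≤ labelled ⟩
    ∑∑ (λ x u → ⟦ isˡ x u ∧ P u ⟧) + ∑∑ (λ x i → ⟦ isʳ x i ∧ Q i ⟧)
      ≡⟨ cong₂ _+_ (∑-comm (λ x u → ⟦ isˡ x u ∧ P u ⟧)) (∑-comm (λ x i → ⟦ isʳ x i ∧ Q i ⟧)) ⟩
    ∑∑ (λ u x → ⟦ isˡ x u ∧ P u ⟧) + ∑∑ (λ i x → ⟦ isʳ x i ∧ Q i ⟧)
      ≤⟨ +-mono-≤
           (sum-mono λ u → sum-unique
             (λ x y p q → label-injective (trans (isˡ-elim x u (proj₁ (∧-elim p))) (sym (isˡ-elim y u (proj₁ (∧-elim q))))))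
             (λ x p → proj₂ (∧-elim {isˡ x u} p)))
           (sum-mono λ i → sum-unique
             (λ x y p q → label-injective (trans (isʳ-elim x i (proj₁ (∧-elim p))) (sym (isʳ-elim y i (proj₁ (∧-elim q))))))
             (λ x p → proj₂ (∧-elim {isʳ x i} p))) ⟩
    sum (λ u → ⟦ P u ⟧) + sum (λ i → ⟦ Q i ⟧)
      ≡⟨ cong₂ _+_ (countTrue-sum P) (countTrue-sum Q) ⟨
    countTrue P + countTrue Q ∎

  leftB : Fin a ⊎ Fin b → Bool
  leftB (inj₁ _) = true
  leftB (inj₂ _) = false

  r : Fin size → Fin size → Bool
  r x y = edgeB graph x y ∧ (leftB (label x) ∧ not (leftB (label y)))

  -- The edge `x y` realises the pair `(u, i)`. Double counting works because a pair in `g` is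
  -- realised at least once and an edge realises at most one pair.
  h : Fin a → Fin b → Fin size → Fin size → Bool
  h u i x y = edgeB graph x y ∧ (isˡ x u ∧ isʳ y i)

  h-elim : ∀ u i x y → h u i x y ≡ true → E graph x y × label x ≡ inj₁ u × label y ≡ inj₂ i
  h-elim u i x y p =
    let e , q = ∧-elim {edgeB graph x y} p ; q₁ , q₂ = ∧-elim {isˡ x u} q
    in e , isˡ-elim x u q₁ , isʳ-elim y i q₂

  realised : ∀ u i → ⟦ g u i ⟧ ≤ ∑∑ (λ x y → ⟦ h u i x y ⟧)
  realised u i with g u i in eq
  ... | false = z≤n
  ... | true with g-edge u i eq
  ...   | x₀ , y₀ , e₀ , p₀ , q₀ with label-edge e₀ p₀ q₀ (λ ())
  ...     | x , y , p , q , e = begin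
    1                                ≡⟨ cong ⟦_⟧ (∧-intro e (∧-intro (⌊⌋-intro (label x ≟L inj₁ u) p) (⌊⌋-intro (label y ≟L inj₂ i) q))) ⟨
    ⟦ h u i x y ⟧                    ≤⟨ term≤sum (λ y → ⟦ h u i x y ⟧) y ⟩
    sum (λ y → ⟦ h u i x y ⟧)        ≤⟨ term≤sum (λ x → sum (λ y → ⟦ h u i x y ⟧)) x ⟩
    ∑∑ (λ x y → ⟦ h u i x y ⟧)       ∎

  inner : ∀ x y → ∑∑ (λ u i → ⟦ h u i x y ⟧) ≤ ⟦ r x y ⟧
  inner x y = ≤-trans
    (sum-mono λ u → sum-unique {p = edgeB graph x y ∧ (isˡ x u ∧ not (leftB (label y)))}
      (λ i j p q → inj₂-inj (trans (sym (proj₂ (proj₂ (h-elim u i x y p)))) (proj₂ (proj₂ (h-elim u j x y q)))))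
      (λ i p → let e , _ , q = h-elim u i x y p in
        ∧-intro e (∧-intro (proj₁ (∧-elim {isˡ x u} (proj₂ (∧-elim {edgeB graph x y} p)))) (cong (not ∘ leftB) q))))
    (sum-unique
      (λ u u′ p q → inj₁-inj (trans (sym (left-elim u p)) (left-elim u′ q)))
      (λ u p → ∧-intro (proj₁ (∧-elim {edgeB graph x y} p))
        (∧-intro (cong leftB (left-elim u p)) (proj₂ (∧-elim {isˡ x u} (proj₂ (∧-elim {edgeB graph x y} p)))))))
    where
    inj₁-inj : ∀ {u u′ : Fin a} → inj₁ {B = Fin b} u ≡ inj₁ u′ → u ≡ u′
    inj₁-inj refl = refl
    inj₂-inj : ∀ {i j : Fin b} → inj₂ {A = Fin a} i ≡ inj₂ j → i ≡ j
    inj₂-inj refl = refl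
    left-elim : ∀ u → edgeB graph x y ∧ (isˡ x u ∧ not (leftB (label y))) ≡ true → label x ≡ inj₁ u
    left-elim u p = isˡ-elim x u (proj₁ (∧-elim (proj₂ (∧-elim {edgeB graph x y} p))))

  edge-bound : ∑∑ (λ u i → ⟦ g u i ⟧) ≤ numEdges graph
  edge-bound = begin
    ∑∑ (λ u i → ⟦ g u i ⟧)                            ≤⟨ ∑∑-mono realised ⟩
    ∑∑ (λ u i → ∑∑ (λ x y → ⟦ h u i x y ⟧))           ≡⟨ ∑∑-∑∑-comm (λ u i x y → ⟦ h u i x y ⟧) ⟩
    ∑∑ (λ x y → ∑∑ (λ u i → ⟦ h u i x y ⟧))           ≤⟨ ∑∑-mono inner ⟩
    ∑∑ (λ x y → ⟦ r x y ⟧)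
      ≤⟨ oriented≤numEdges graph r (λ x y p → proj₁ (∧-elim p))
           (λ x y p q → true≢false (proj₁ (∧-elim (proj₂ (∧-elim {edgeB graph x y} p))))
                                   (not-true (proj₂ (∧-elim {leftB (label y)} (proj₂ (∧-elim {edgeB graph y x} q)))))) ⟩
    numEdges graph                                    ∎

-- Breadth-first trees

-- The conditions on `parent` are stated at `depth v ≡ suc ℓ`, since the root has no parent edge and
-- the explicit predecessor drives the inductions on depth.
record RootedTree {n} (G : Adj n) (D : ℕ) : Set where
  field
    root         : Fin n
    parent       : Fin n → Fin n
    depth        : Fin n → ℕ
    depth≤D      : ∀ v → depth v ≤ D
    depth-root   : ∀ v → depth v ≡ 0 → v ≡ root
    parent-edge  : ∀ {v ℓ} → depth v ≡ suc ℓ → E G v (parent v)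
    parent-depth : ∀ {v ℓ} → depth v ≡ suc ℓ → depth (parent v) ≡ ℓ

least : ∀ {P : ℕ → Set} → (∀ ℓ → Dec (P ℓ)) → ∀ m → P m → ∃[ ℓ ] (P ℓ × (∀ j → P j → ℓ ≤ j))
least P? zero    p = 0 , p , λ _ _ → z≤n
least P? (suc m) p with P? 0
... | yes p₀ = 0 , p₀ , λ _ _ → z≤n
... | no ¬p₀ with least (P? ∘ suc) m p
...   | ℓ , q , min = suc ℓ , q , λ { zero p₀ → contradiction p₀ ¬p₀ ; (suc j) pⱼ → s≤s (min j pⱼ) }

walk? : ∀ {n} (G : Adj n) ℓ u v → Dec (Walk (E G) u v ℓ)
walk? G zero u v with u ≟ v
... | yes refl = yes []
... | no u≢v   = no λ { [] → u≢v refl }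
walk? G (suc ℓ) u v with any? (λ w → edgeB G u w ≟ᵇ true ×-dec walk? G ℓ w v)
... | yes (w , e , p) = yes (e ∷ p)
... | no none         = no λ { (e ∷ p) → none (_ , e , p) }

-- Depth is the distance to the root, and the parent is the second vertex of a chosen shortest walk
-- to it.
breadthFirst : ∀ {n} (G : Adj n) D → Fin n → (∀ u v → ∃[ ℓ ] (ℓ ≤ D × Walk (E G) u v ℓ)) → RootedTree G D
breadthFirst {n} G D root reach = record
  { root         = root
  ; parent       = λ v → hop (depth v) (walk v)
  ; depth        = depth
  ; depth≤D      = λ v → let ℓ , ℓ≤D , w = reach v root in ≤-trans (shortest v ℓ w) ℓ≤D
  ; depth-root   = λ v p → no-hop (walk v) p
  ; parent-edge  = λ {v} p → hop-edge (walk v) p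
  ; parent-depth = λ {v} p → hop-depth (walk v) p
  }
  where
  nearest : ∀ v → ∃[ ℓ ] (Walk (E G) v root ℓ × (∀ j → Walk (E G) v root j → ℓ ≤ j))
  nearest v = let ℓ , _ , w = reach v root in least (λ ℓ → walk? G ℓ v root) ℓ w

  depth : Fin n → ℕ
  depth v = proj₁ (nearest v)

  walk : ∀ v → Walk (E G) v root (depth v)
  walk v = proj₁ (proj₂ (nearest v))

  shortest : ∀ v j → Walk (E G) v root j → depth v ≤ j
  shortest v = proj₂ (proj₂ (nearest v))

  hop : ∀ {v} ℓ → Walk (E G) v root ℓ → Fin n
  -- At the root the parent defaults to the root itself.
  hop {v} _ []            = v
  hop     _ (_∷_ {w = w} _ _) = w

  no-hop : ∀ {v ℓ} → Walk (E G) v root ℓ → ℓ ≡ 0 → v ≡ root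
  no-hop [] _ = refl

  hop-edge : ∀ {v ℓ m} (w : Walk (E G) v root ℓ) → ℓ ≡ suc m → E G v (hop ℓ w)
  hop-edge (e ∷ _) _ = e

  hop-depth : ∀ {v m} (w : Walk (E G) v root (depth v)) → depth v ≡ suc m → depth (hop (depth v) w) ≡ m
  hop-depth {v} w p = go w refl p
    where
    go : ∀ {ℓ m} (w : Walk (E G) v root ℓ) → ℓ ≡ depth v → ℓ ≡ suc m → depth (hop ℓ w) ≡ m
    -- The rest of the walk bounds the depth of the parent from above; prepending the edge to a
    -- shortest walk of the parent bounds it from below.
    go (_∷_ {w = x} e w) p refl = ≤-antisym (shortest x _ w)
      (s≤s⁻¹ (≤-trans (≤-reflexive p) (shortest v _ (e ∷ walk x))))

-- Walks

_++ʷ_ : ∀ {n} {R : Fin n → Fin n → Set} {x y z a b} → Walk R x y a → Walk R y z b → Walk R x z (a + b)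
[]      ++ʷ q = q
(e ∷ p) ++ʷ q = e ∷ (p ++ʷ q)

snocʷ : ∀ {n} {R : Fin n → Fin n → Set} {x y z a} → Walk R x y a → R y z → Walk R x z (suc a)
snocʷ []      e = e ∷ []
snocʷ (f ∷ p) e = f ∷ snocʷ p e

reverseʷ : ∀ {n} {R : Fin n → Fin n → Set} → (∀ {x y} → R x y → R y x) →
           ∀ {x y a} → Walk R x y a → Walk R y x a
reverseʷ R-sym []      = []
reverseʷ R-sym (e ∷ p) = snocʷ (reverseʷ R-sym p) (R-sym e)

mapʷ : ∀ {n} {R S : Fin n → Fin n → Set} → (∀ {x y} → R x y → S x y) →
       ∀ {x y a} → Walk R x y a → Walk S x y a
mapʷ f []      = []
mapʷ f (e ∷ p) = f e ∷ mapʷ f p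

-- Vertices are grouped into blocks by lab; two visible vertices of one block are at distance at most s.
-- A walk is shortened by jumping, inside the block it starts in, to the last vertex of that block.
module Shorten {n} (R : Fin n → Fin n → Set) (Vis : Fin n → Set) (lab : Fin n → Fin n) (s : ℕ)
  (near : ∀ {x y} → Vis x → Vis y → lab x ≡ lab y → ∃[ ℓ ] (ℓ ≤ s × Walk R x y ℓ)) where

  record Allowed (S : Fin n → Bool) (x : Fin n) : Set where
    constructor allowed
    field
      visible : Vis x
      inBlock : S (lab x) ≡ true
  open Allowed

  Through : (Fin n → Bool) → Fin n → Fin n → Set
  Through S x y = R x y × Allowed S x × Allowed S y

  _∖_ : (Fin n → Bool) → Fin n → Fin n → Bool
  (S ∖ a) t = S t ∧ not (eqB t a)

  ∖-count : ∀ S a → S a ≡ true → suc (countTrue (S ∖ a)) ≤ countTrue S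
  ∖-count S a Sa = ≤-trans
    (+-monoˡ-≤ _ (countTrue-any {f = λ t → S t ∧ eqB t a} a (∧-intro Sa (eqB-intro {u = a} refl))))
    (≤-reflexive (sym (countTrue-split S (λ t → eqB t a))))

  ∖-allowed : ∀ {S a x} → lab x ≢ a → Allowed S x → Allowed (S ∖ a) x
  ∖-allowed x∉a (allowed vis S) = allowed vis (∧-intro S (false-not (eqB-intro-¬ x∉a)))

  Exit : (Fin n → Bool) → Fin n → Fin n → Set
  Exit S a v = ∃[ x ] (Vis x × lab x ≡ a × (x ≡ v ⊎ ∃[ y ] ∃[ ℓ ] (R x y × Allowed (S ∖ a) y × Walk (Through (S ∖ a)) y v ℓ)))

  -- The tail is examined before the head, so the vertex found is the last one in block `a`, and
  -- what follows it lives on the smaller set of blocks.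
  lastVisit : ∀ S a {x v ℓ} → Allowed S x → Walk (Through S) x v ℓ →
              (lab x ≢ a × Walk (Through (S ∖ a)) x v ℓ) ⊎ Exit S a v
  lastVisit S a {x} ok [] with lab x ≟ a
  ... | yes x∈a = inj₂ (x , visible ok , x∈a , inj₁ refl)
  ... | no x∉a  = inj₁ (x∉a , [])
  lastVisit S a {x} ok (_∷_ {w = y} (e , _ , ok′) p) with lastVisit S a ok′ p
  ... | inj₂ exit = inj₂ exit
  ... | inj₁ (y∉a , p′) with lab x ≟ a
  ...   | yes x∈a = inj₂ (x , visible ok , x∈a , inj₂ (y , _ , e , ∖-allowed y∉a ok′ , p′))
  ...   | no x∉a  = inj₁ (x∉a , (e , ∖-allowed x∉a ok , ∖-allowed y∉a ok′) ∷ p′)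

  -- A block is left for good after one jump of length at most `s` and one edge out of it, hence
  -- `suc s` per block; `t` bounds the number of blocks still available.
  shorten : ∀ t S → countTrue S ≤ t → ∀ {u v ℓ} → Allowed S u → Walk (Through S) u v ℓ →
            ∃[ ℓ′ ] (ℓ′ ≤ t * suc s × Walk R u v ℓ′)
  shorten zero S few {u} ok p = case ≤-trans (countTrue-any (lab u) (inBlock ok)) few of λ ()
  shorten (suc t) S few {u} ok p with lastVisit S (lab u) ok p
  ... | inj₁ (u∉u , _) = contradiction refl u∉u
  ... | inj₂ (x , vis , same , inj₁ refl) = let ℓ , ℓ≤s , q = near (visible ok) vis (sym same) in
    ℓ , ≤-trans ℓ≤s (≤-trans (n≤1+n s) (m≤m+n (suc s) (t * suc s))) , q
  ... | inj₂ (x , vis , same , inj₂ (y , _ , e , ok′ , p′)) =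
    let ℓ₁ , ℓ₁≤ , q₁ = near (visible ok) vis (sym same)
        ℓ₂ , ℓ₂≤ , q₂ = shorten t (S ∖ lab u) (s≤s⁻¹ (≤-trans (∖-count S (lab u) (inBlock ok)) few)) ok′ p′
    in ℓ₁ + suc ℓ₂ , ≤-trans (≤-reflexive (+-suc ℓ₁ ℓ₂)) (+-mono-≤ (s≤s ℓ₁≤) ℓ₂≤) , q₁ ++ʷ (e ∷ q₂)

-- Cutting the tree at congested edges

-- The edge from a vertex to its parent is identified with the vertex. From the leaves up, it is
-- cut as soon as at least c active parts reach it through uncut edges.
module Cut {n k} {G : Adj n} {D : ℕ} (T : RootedTree G D) (part : Fin n → Fin k) (A : Fin k → Bool) (c : ℕ) where

  open RootedTree T

  child : Fin n → Fin n → Bool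
  child w v = ⌊ depth w ≟ℕ suc (depth v) ⌋ ∧ eqB (parent w) v

  -- The first argument is the height D ∸ depth v of v above the deepest level.
  mutual
    seesAt : ℕ → Fin n → Fin k → Bool
    seesAt zero    v i = A i ∧ eqB (part v) i
    seesAt (suc h) v i = (A i ∧ eqB (part v) i) ∨
      ⌊ any? (λ w → (child w v ∧ (not (cutAt h w) ∧ seesAt h w i)) ≟ᵇ true) ⌋

    cutAt : ℕ → Fin n → Bool
    cutAt h v = ⌊ c ≤? countTrue (seesAt h v) ⌋

  sees : Fin n → Fin k → Bool
  sees v = seesAt (D ∸ depth v) v

  cut : Fin n → Bool
  cut v = cutAt (D ∸ depth v) v

  cut-many : ∀ v → cut v ≡ true → c ≤ countTrue (sees v)
  cut-many v = ⌊⌋-elim (c ≤? countTrue (sees v))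

  uncut-few : ∀ v → cut v ≡ false → countTrue (sees v) ≤ c
  uncut-few v p = ≰⇒≥ λ many → true≢false (⌊⌋-intro (c ≤? countTrue (sees v)) many) p

  seesAt-own : ∀ h {v i} → A i ≡ true → part v ≡ i → seesAt h v i ≡ true
  seesAt-own zero    Ai pv = ∧-intro Ai (eqB-intro pv)
  seesAt-own (suc h) Ai pv = ∨-introˡ _ (∧-intro Ai (eqB-intro pv))

  sees-own : ∀ {v i} → A i ≡ true → part v ≡ i → sees v i ≡ true
  sees-own {v} = seesAt-own (D ∸ depth v)

  height-parent : ∀ {w ℓ} → depth w ≡ suc ℓ → D ∸ depth (parent w) ≡ suc (D ∸ depth w)
  height-parent {w} {ℓ} p rewrite parent-depth p | p =
    +-∸-assoc 1 {D} {suc ℓ} (subst (_≤ D) p (depth≤D w))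

  sees-parent : ∀ {w ℓ i} → depth w ≡ suc ℓ → cut w ≡ false → sees w i ≡ true → sees (parent w) i ≡ true
  sees-parent {w} {ℓ} {i} p uncut s = subst (λ h → seesAt h (parent w) i ≡ true) (sym (height-parent p))
    (∨-introʳ (A i ∧ _) (⌊⌋-intro (any? _) (w , ∧-intro
      (∧-intro (⌊⌋-intro (depth w ≟ℕ suc (depth (parent w))) (trans p (cong suc (sym (parent-depth p))))) (eqB-intro {u = parent w} refl))
      (∧-intro (false-not uncut) s))))

  -- A path from v down through uncut edges that ends on reaching part i; the list omits the endpoint.
  data Trail (i : Fin k) : Fin n → List (Fin n) → Set where
    here  : ∀ {v} → part v ≡ i → Trail i v []
    below : ∀ {v w xs} → part v ≢ i → depth w ≡ suc (depth v) → parent w ≡ v → cut w ≡ false →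
            Trail i w xs → Trail i v (v ∷ xs)

  TrailFrom : Fin n → Fin k → Set
  TrailFrom v i = ∃[ xs ] (Trail i v xs × length xs ≤ D)

  trailAt : ∀ h v i → D ∸ depth v ≡ h → seesAt h v i ≡ true →
            A i ≡ true × ∃[ xs ] (Trail i v xs × length xs ≤ h)
  trailAt zero v i _ s = let Ai , pv = ∧-elim s in Ai , [] , here (eqB-elim pv) , z≤n
  trailAt (suc h) v i eq s with ∨-elim {A i ∧ eqB (part v) i} s
  ... | inj₁ s′ = let Ai , pv = ∧-elim s′ in Ai , [] , here (eqB-elim pv) , z≤n
  ... | inj₂ s′ with ⌊⌋-elim (any? _) s′
  ...   | w , q = descend (part v ≟ i)
    where
    ch = ∧-elim {⌊ depth w ≟ℕ suc (depth v) ⌋} (proj₁ (∧-elim {child w v} q))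
    dw : depth w ≡ suc (depth v)
    dw = ⌊⌋-elim (depth w ≟ℕ suc (depth v)) (proj₁ ch)
    hw : D ∸ depth w ≡ h
    hw = trans (cong (D ∸_) dw) (trans (sym (pred[m∸n]≡m∸[1+n] D (depth v))) (cong pred eq))
    uncut-sees = ∧-elim {not (cutAt h w)} (proj₂ (∧-elim {child w v} q))
    uncut : cut w ≡ false
    uncut = subst (λ h → cutAt h w ≡ false) (sym hw) (not-true (proj₁ uncut-sees))
    rec = trailAt h w i hw (proj₂ uncut-sees)
    descend : Dec (part v ≡ i) → A i ≡ true × ∃[ xs ] (Trail i v xs × length xs ≤ suc h)
    -- Stopping as soon as the part is met keeps every listed vertex outside it, as `below` demands.
    descend (yes pv) = proj₁ rec , [] , here pv , z≤n
    descend (no ¬pv) = let Ai , xs , tr , len = rec in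
      Ai , v ∷ xs , below ¬pv dw (eqB-elim (proj₂ ch)) uncut tr , s≤s len

  sees-active : ∀ v i → sees v i ≡ true → A i ≡ true
  sees-active v i s = proj₁ (trailAt _ v i refl s)

  trail : ∀ v i → sees v i ≡ true → TrailFrom v i
  trail v i s = let _ , xs , tr , len = trailAt _ v i refl s in xs , tr , ≤-trans len (m∸n≤m D (depth v))

  trail-sees : ∀ {i v xs} → A i ≡ true → Trail i v xs → sees v i ≡ true
  trail-sees Ai (here pv)               = sees-own Ai pv
  trail-sees Ai (below _ dw refl uc tr) = sees-parent dw uc (trail-sees Ai tr)

  crossings : Fin k → ℕ
  crossings i = countTrue (λ v → cut v ∧ sees v i)

  -- Edges are stored from child to parent only; the symmetric reading then costs the factor two in
  -- `shortcut-congestion`.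
  shortcut : Fin k → Subgraph n
  shortcut i = record
    { vert = λ x → sees x i
    ; edge = λ x y → ⌊ 1 ≤? depth x ⌋ ∧ (eqB (parent x) y ∧ (not (cut x) ∧ sees x i))
    }

  record Uses (i : Fin k) (x y : Fin n) : Set where
    constructor uses
    field
      {level}   : ℕ
      level≡    : depth x ≡ suc level
      parent≡   : parent x ≡ y
      uncut     : cut x ≡ false
      seen      : sees x i ≡ true

  uses-elim : ∀ i x y → edge (shortcut i) x y ≡ true → Uses i x y
  uses-elim i x y p =
    let d , q     = ∧-elim {⌊ 1 ≤? depth x ⌋} p
        r , s     = ∧-elim {eqB (parent x) y} q
        u , t     = ∧-elim {not (cut x)} s
        ℓ , level = positive (⌊⌋-elim (1 ≤? depth x) d)
    in uses level (eqB-elim r) (not-true u) t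
    where
    positive : ∀ {m} → 1 ≤ m → ∃[ ℓ ] m ≡ suc ℓ
    positive (s≤s _) = _ , refl

  uses-intro : ∀ i x y → Uses i x y → edge (shortcut i) x y ≡ true
  uses-intro i x y (uses dx py uc s) = ∧-intro
    (⌊⌋-intro (1 ≤? depth x) (subst (1 ≤_) (sym dx) (s≤s z≤n)))
    (∧-intro (eqB-intro py) (∧-intro (false-not uc) s))

  shortcut-subgraph : ∀ i → IsSubgraphOf (shortcut i) G
  shortcut-subgraph i x y p with uses-elim i x y p
  ... | uses dx refl uc s = parent-edge dx , s , sees-parent dx uc s

  edge-congestion : ∀ x y → countTrue (λ i → edge (shortcut i) x y) ≤ c
  edge-congestion x y with toSum (cut x ≟ᵇ false)
  ... | inj₁ uc = ≤-trans (countTrue-mono (λ i p → Uses.seen (uses-elim i x y p))) (uncut-few x uc)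
  ... | inj₂ ct = ≤-trans (≤-reflexive (countTrue-none λ i → ¬true⇒false λ p → ct (Uses.uncut (uses-elim i x y p)))) z≤n

  shortcut-congestion : ∀ x y → countTrue (λ i → inHB (shortcut i) x y) ≤ c + c
  shortcut-congestion x y = ≤-trans
    (countTrue-∪ (λ i → ∨-elim {edge (shortcut i) x y}))
    (+-mono-≤ (edge-congestion x y) (edge-congestion y x))

  module _ {i} (Ai : A i ≡ true) where

    Plus : Fin n → Fin n → Set
    Plus = PlusE G part i (shortcut i)

    Plus-sym : ∀ {x y} → Plus x y → Plus y x
    Plus-sym (inj₁ (e , p , q))  = inj₁ (E-sym {G = G} e , q , p)
    Plus-sym {x} {y} (inj₂ p)    = inj₂ (trans (∨-comm (edge (shortcut i) y x) _) p)

    Sees : Fin n → Set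
    Sees x = sees x i ≡ true

    up : ∀ {x ℓ} → depth x ≡ suc ℓ → cut x ≡ false → Sees x → Plus x (parent x)
    up {x} dx uc s = inj₂ (∨-introˡ _ (uses-intro i x (parent x) (uses dx refl uc s)))

    use-sees : ∀ {x y} → Uses i x y → Sees x × Sees y
    use-sees (uses dx refl uc s) = s , sees-parent dx uc s

    plus-sees : ∀ {x y} → Plus x y → Sees x × Sees y
    plus-sees (inj₁ (_ , p , q)) = sees-own Ai p , sees-own Ai q
    plus-sees {x} {y} (inj₂ p) with ∨-elim {edge (shortcut i) x y} p
    ... | inj₁ q = use-sees (uses-elim i x y q)
    ... | inj₂ q = let s , t = use-sees (uses-elim i y x q) in t , s

    vertex-sees : ∀ {x} → PlusV part i (shortcut i) x → Sees x
    vertex-sees (inj₁ px) = sees-own Ai px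
    vertex-sees (inj₂ s)  = s

    -- With `ℓ` the depth of `x`, this is the root of the piece of the cut tree that contains `x`;
    -- the pieces are the blocks given to `Shorten`.
    topAt : ℕ → Fin n → Fin n
    topAt zero    x = x
    topAt (suc ℓ) x = if cut x then x else topAt ℓ (parent x)

    top : Fin n → Fin n
    top x = topAt (depth x) x

    topB : Fin n → Bool
    topB t = (cut t ∨ eqB t root) ∧ sees t i

    climb : ∀ ℓ x → depth x ≡ ℓ → Sees x → topB (topAt ℓ x) ≡ true × ∃[ m ] (m ≤ ℓ × Walk Plus x (topAt ℓ x) m)
    climb zero x dx s = ∧-intro (∨-introʳ (cut x) (eqB-intro (depth-root x dx))) s , 0 , z≤n , []
    climb (suc ℓ) x dx s with cut x in cx
    ... | true  = ∧-intro (∨-introˡ _ cx) s , 0 , z≤n , []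
    ... | false = let t , m , m≤ℓ , w = climb ℓ (parent x) (parent-depth dx) (sees-parent dx cx s) in
      t , suc m , s≤s m≤ℓ , up dx cx s ∷ w

    near-top : ∀ {x y} → Sees x → Sees y → top x ≡ top y → ∃[ ℓ ] (ℓ ≤ D + D × Walk Plus x y ℓ)
    near-top {x} {y} sx sy eq =
      let _ , a , a≤ , p = climb (depth x) x refl sx
          _ , b , b≤ , q = climb (depth y) y refl sy
      in a + b , +-mono-≤ (≤-trans a≤ (depth≤D x)) (≤-trans b≤ (depth≤D y)) ,
         (p ++ʷ reverseʷ Plus-sym (subst (λ t → Walk Plus y t b) (sym eq) q))

    -- The extra one is for the piece of the root of the tree, whose top need not be cut.
    top-count : countTrue topB ≤ suc (crossings i)
    top-count = ≤-trans
      (countTrue-∪ {g = λ t → eqB t root} {h = λ t → cut t ∧ sees t i} split)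
      (+-monoˡ-≤ (crossings i) (countTrue-unique {f = λ t → eqB t root} (λ x y p q → trans (eqB-elim p) (sym (eqB-elim q)))))
      where
      split : ∀ t → topB t ≡ true → eqB t root ≡ true ⊎ cut t ∧ sees t i ≡ true
      split t p with ∧-elim {cut t ∨ eqB t root} p
      ... | q , s with ∨-elim {cut t} q
      ...   | inj₁ ct = inj₂ (∧-intro ct s)
      ...   | inj₂ r  = inj₁ r

    trail-walk : ∀ {v xs} → Trail i v xs → ∃[ p ] ∃[ ℓ ] (part p ≡ i × Walk Plus v p ℓ)
    trail-walk {v} (here pv) = v , 0 , pv , []
    trail-walk (below _ dw refl uc tr) = let p , ℓ , pp , w = trail-walk tr in
      p , suc ℓ , pp , Plus-sym (up dw uc (trail-sees Ai tr)) ∷ w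

    open Shorten Plus Sees top (D + D) near-top

    -- The walk handed to `shorten` may be arbitrarily long: both ends follow their trails down into
    -- part `i`, and the part is connected. All its vertices see `i`, so it stays in the pieces
    -- counted by `top-count`.
    shortcut-dilation : PartConnected G part i → ∀ u v → PlusV part i (shortcut i) u → PlusV part i (shortcut i) v →
                        ∃[ ℓ ] (ℓ ≤ suc (crossings i) * suc (D + D) × Walk Plus u v ℓ)
    shortcut-dilation (_ , connected) u v pu pv =
      let su = vertex-sees pu ; sv = vertex-sees pv
          _ , tu , _ = trail u i su ; _ , tv , _ = trail v i sv
          p , _ , pp , wu = trail-walk tu
          q , _ , pq , wv = trail-walk tv
          _ , wpq = connected p q pp pq
          w = wu ++ʷ (mapʷ inj₁ wpq ++ʷ reverseʷ Plus-sym wv)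
      in shorten (suc (crossings i)) topB top-count (allow su) (mapʷ through w)
      where
      allow : ∀ {x} → Sees x → Allowed topB x
      allow {x} s = allowed s (proj₁ (climb (depth x) x refl s))
      through : ∀ {x y} → Plus x y → Through topB x y
      through e = let s , t = plus-sees e in e , allow s , allow t

-- Counting the cut edges crossed by the parts

-- Minor density at most `d`, cleared of the denominator so as to include the empty minor.
Sparse : ∀ {n} → ℕ → Adj n → Set
Sparse d G = ∀ {m} (H : Adj m) → Minor H G → numEdges H ≤ d * m

total : ∀ {n k} → (Fin n → Fin k) → (Fin k → ℕ) → List (Fin n) → ℕ
total part g []       = 0
total part g (x ∷ xs) = g (part x) + total part g xs

total-1 : ∀ {n k} (part : Fin n → Fin k) xs → total part (λ _ → 1) xs ≡ length xs
total-1 part []       = refl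
total-1 part (x ∷ xs) = cong suc (total-1 part xs)

total-zero : ∀ {n k} (part : Fin n → Fin k) g xs → total part g xs ≡ 0 → All (λ x → g (part x) ≡ 0) xs
total-zero part g []       p = []
total-zero part g (x ∷ xs) p = m+n≡0⇒m≡0 _ p ∷ total-zero part g xs (m+n≡0⇒n≡0 (g (part x)) p)

visits : ∀ {n k} → (Fin n → Fin k) → Fin k → List (Fin n) → ℕ
visits part j = total part (λ p → ⟦ eqB p j ⟧)

sum-visits : ∀ {n k} (part : Fin n → Fin k) g xs → sum (λ j → g j * visits part j xs) ≡ total part g xs
sum-visits part g []       = sum-zero _ (λ j → *-zeroʳ (g j))
sum-visits part g (x ∷ xs) = trans
  (sum-cong-≗ (λ j → *-distribˡ-+ (g j) ⟦ eqB (part x) j ⟧ (visits part j xs)))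
  (trans (∑-distrib-+ (λ j → g j * ⟦ eqB (part x) j ⟧) (λ j → g j * visits part j xs))
    (cong₂ _+_ (trans (sum-cong-≗ pick) (sum-δ (part x) (g (part x)))) (sum-visits part g xs)))
  where
  pick : ∀ j → g j * ⟦ eqB (part x) j ⟧ ≡ ⟦ eqB (part x) j ⟧ * g (part x)
  pick j with part x ≟ j
  ... | yes refl = *-comm (g (part x)) 1
  ... | no _     = *-zeroʳ (g j)

module Crossings {n k} {G : Adj n} {D : ℕ} (T : RootedTree G D) (part : Fin n → Fin k) (A : Fin k → Bool) (c : ℕ)
  (part-connected : ∀ i → PartConnected G part i) where

  open RootedTree T
  open Cut T part A c

  -- Branch sets: the parts in S, and for each cut vertex t the vertices below t that reach t
  -- through uncut edges while avoiding the parts in S.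
  module Contraction (S : Fin k → Bool) where

    -- Inductions run over this relation, while `blockAt` computes the same block, as the labelling
    -- `β` has to be a function.
    data Block (t : Fin n) : Fin n → Set where
      atTop : S (part t) ≡ false → cut t ≡ true → Block t t
      lower : ∀ {x ℓ} → S (part x) ≡ false → cut x ≡ false → depth x ≡ suc ℓ → Block t (parent x) → Block t x

    mutual
      blockAt : ℕ → Fin n → Maybe (Fin n)
      blockAt ℓ x = if S (part x) then nothing else (if cut x then just x else blockAbove ℓ x)

      blockAbove : ℕ → Fin n → Maybe (Fin n)
      -- The climb has reached an uncut root without meeting a cut vertex: such vertices belong to
      -- no branch set and are deleted.
      blockAbove zero    x = nothing
      blockAbove (suc ℓ) x = blockAt ℓ (parent x)

    blockAt-sound : ∀ ℓ x {t} → depth x ≡ ℓ → blockAt ℓ x ≡ just t → Block t x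
    blockAt-sound ℓ x dx p with S (part x) in Sx
    blockAt-sound ℓ x dx p | false with cut x in cx
    blockAt-sound ℓ x dx refl | false | true = atTop Sx cx
    blockAt-sound (suc ℓ) x dx p | false | false = lower Sx cx dx (blockAt-sound ℓ (parent x) (parent-depth dx) p)

    blockAt-complete : ∀ ℓ {x t} → depth x ≡ ℓ → Block t x → blockAt ℓ x ≡ just t
    blockAt-complete ℓ dx (atTop Sx cx) = trans (if-false Sx) (if-true cx)
    blockAt-complete zero dx (lower Sx cx dx′ b) = case trans (sym dx) dx′ of λ ()
    blockAt-complete (suc ℓ) dx (lower Sx cx _ b) =
      trans (if-false Sx) (trans (if-false cx) (blockAt-complete ℓ (parent-depth dx) b))

    β : Fin n → Maybe (Fin n ⊎ Fin k)
    β x = if S (part x) then just (inj₂ (part x)) else Maybe.map inj₁ (blockAt (depth x) x)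

    β-part : ∀ {x i} → S i ≡ true → part x ≡ i → β x ≡ just (inj₂ i)
    β-part Si refl = if-true Si

    Block-S : ∀ {t x} → Block t x → S (part x) ≡ false
    Block-S (atTop Sx _)     = Sx
    Block-S (lower Sx _ _ _) = Sx

    Block-cut : ∀ {t x} → Block t x → cut t ≡ true
    Block-cut (atTop _ ct)    = ct
    Block-cut (lower _ _ _ b) = Block-cut b

    β-block : ∀ {x t} → Block t x → β x ≡ just (inj₁ t)
    β-block b = trans (if-false (Block-S b)) (cong (Maybe.map inj₁) (blockAt-complete _ refl b))

    β-elimˡ : ∀ x {t} → β x ≡ just (inj₁ t) → Block t x
    β-elimˡ x p = blockAt-sound (depth x) x refl (block (S (part x)) (blockAt (depth x) x) p)
      where
      block : ∀ b m {j t} → (if b then just (inj₂ j) else Maybe.map inj₁ m) ≡ just (inj₁ t) → m ≡ just t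
      block false (just t) refl = refl

    β-elimʳ : ∀ x {i} → β x ≡ just (inj₂ i) → S i ≡ true × part x ≡ i
    β-elimʳ x p = inS (S (part x)) (blockAt (depth x) x) refl p
      where
      inS : ∀ b m {i} → S (part x) ≡ b → (if b then just (inj₂ (part x)) else Maybe.map inj₁ m) ≡ just (inj₂ i) →
            S i ≡ true × part x ≡ i
      inS true m Sx refl = Sx , refl
      inS false nothing _ ()
      inS false (just _) _ ()

    block-star : ∀ {t x} → Block t x → Star (Same G β) x t
    block-star (atTop _ _) = ε
    block-star {t} {x} (lower Sx cx dx b) =
      (parent-edge dx , trans (β-block (lower Sx cx dx b)) (sym (β-block b))) ◅ block-star b

    part-star : ∀ {i x y ℓ} → S i ≡ true → Walk (InducedE G part i) x y ℓ → Star (Same G β) x y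
    part-star Si []                  = ε
    part-star Si ((e , p , q) ∷ w) = (e , trans (β-part Si p) (sym (β-part Si q))) ◅ part-star Si w

    branchSets : BranchSets G β
    branchSets {x} {y} {inj₁ t} p q =
      block-star (β-elimˡ x p) ◅◅ reverse (λ { (e , s) → E-sym {G = G} e , sym s }) (block-star (β-elimˡ y q))
    branchSets {x} {y} {inj₂ i} p q =
      let Si , px = β-elimʳ x p ; _ , py = β-elimʳ y q in part-star Si (proj₂ (proj₂ (part-connected i) x y px py))

    -- The trail avoids `S`, so its vertices join the block of `t` one by one; the last one listed
    -- has a tree edge down into part `i`.
    trail-edge : ∀ {i t x xs} → S i ≡ true → part x ≢ i → Block t x → Trail i x xs →
                 All (λ x → S (part x) ≡ false) xs →
                 ∃₂ λ x y → E G x y × β x ≡ just (inj₁ t) × β y ≡ just (inj₂ i)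
    trail-edge Si x∉i b (here x∈i) _ = contradiction x∈i x∉i
    trail-edge {x = x} Si x∉i b (below {w = w} _ dw refl uc (here w∈i)) _ =
      x , w , E-sym {G = G} (parent-edge dw) , β-block b , β-part Si w∈i
    trail-edge Si x∉i b (below _ dw refl uc (below w∉i dw′ pw′ uc′ tr)) (_ ∷ (Sw ∷ clear)) =
      trail-edge Si w∉i (lower Sw uc dw b) (below w∉i dw′ pw′ uc′ tr) (Sw ∷ clear)

    -- There is at most one branch set per cut vertex and one per part in `S`, and every pair in `g`
    -- contributes its own edge through `trail-edge`.
    minor-bound : ∀ {d} → Sparse d G → (g : Fin n → Fin k → Bool) →
                  (∀ v i → g v i ≡ true → cut v ≡ true × S i ≡ true × part v ≢ i ×
                     ∃[ xs ] (Trail i v xs × All (λ x → S (part x) ≡ false) xs)) →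
                  ∑∑ (λ v i → ⟦ g v i ⟧) ≤ d * (countTrue cut + countTrue S)
    minor-bound {d} sparse g g-trail =
      let m , H , minor , small , many =
            bipartiteMinor G β branchSets cut (λ x p → Block-cut (β-elimˡ x p)) S (λ x p → proj₁ (β-elimʳ x p)) g
              (λ v i p → let cv , Si , v∉i , xs , tr , clear = g-trail v i p in
                trail-edge Si v∉i (atTop (first v∉i tr clear) cv) tr clear)
      in ≤-trans many (≤-trans (sparse H minor) (*-monoʳ-≤ d small))
      where
      first : ∀ {i v xs} → part v ≢ i → Trail i v xs → All (λ x → S (part x) ≡ false) xs → S (part v) ≡ false
      first v∉i (here v∈i)        _        = contradiction v∈i v∉i
      first v∉i (below _ _ _ _ _) (Sv ∷ _) = Sv

module Counting {n k} {G : Adj n} {D′ : ℕ} (T : RootedTree G (suc D′)) (part : Fin n → Fin k) (A : Fin k → Bool) (c : ℕ)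
  (part-connected : ∀ i → PartConnected G part i) {d : ℕ} (sparse : Sparse d G) where

  open RootedTree T
  open Cut T part A c
  open Crossings T part A c part-connected

  D : ℕ
  D = suc D′

  -- The part that contains `v` itself is left out, as its trail is empty and yields no edge of the
  -- minor.
  pairB : Fin n → Fin k → Bool
  pairB v i = (cut v ∧ sees v i) ∧ not (eqB (part v) i)

  record Pair (v : Fin n) (i : Fin k) : Set where
    constructor pair
    field
      isCut   : cut v ≡ true
      isSeen  : sees v i ≡ true
      outside : part v ≢ i

  pair-elim : ∀ v i → pairB v i ≡ true → Pair v i
  pair-elim v i p =
    let q , r = ∧-elim {cut v ∧ sees v i} p ; s , t = ∧-elim {cut v} q
    in pair s t (λ v∈i → true≢false (eqB-intro v∈i) (not-true r))

  -- A total version of `trail`, so that routes can be summed over all `v` and `i`; the empty list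
  -- is a default where there is no trail.
  route : Fin n → Fin k → List (Fin n)
  route v i with sees v i ≟ᵇ true
  ... | yes s = proj₁ (trail v i s)
  ... | no _  = []

  route-trail : ∀ v i → sees v i ≡ true → Trail i v (route v i)
  route-trail v i s with sees v i ≟ᵇ true
  ... | yes s′ = proj₁ (proj₂ (trail v i s′))
  ... | no ¬s  = contradiction s ¬s

  route-length : ∀ v i → length (route v i) ≤ D
  route-length v i with sees v i ≟ᵇ true
  ... | yes s = proj₂ (proj₂ (trail v i s))
  ... | no _  = z≤n

  trail-avoids : ∀ {i v xs} → Trail i v xs → visits part i xs ≡ 0
  trail-avoids (here _)              = refl
  trail-avoids (below v∉i _ _ _ tr) = cong₂ (λ b m → ⟦ b ⟧ + m) (eqB-intro-¬ v∉i) (trail-avoids tr)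

  -- The cost of giving `i` and `j` the same colour: how often part `j` then obstructs the routes to
  -- part `i`.
  weight : Fin k → Fin k → ℕ
  weight i j = sum (λ v → ⟦ pairB v i ⟧ * visits part j (route v i))

  weight-diag : ∀ i → weight i i ≡ 0
  weight-diag i = sum-zero _ none
    where
    none : ∀ v → ⟦ pairB v i ⟧ * visits part i (route v i) ≡ 0
    none v with pairB v i in eq
    ... | false = refl
    ... | true  = trans (+-identityʳ _) (trail-avoids (route-trail v i (Pair.isSeen (pair-elim v i eq))))

  weighted : ∀ (g : Fin k → Fin k → ℕ) →
             ∑∑ (λ i j → g i j * weight i j) ≡ ∑∑ (λ v i → ⟦ pairB v i ⟧ * total part (g i) (route v i))
  weighted g = begin
    ∑∑ (λ i j → g i j * weight i j)
      ≡⟨ ∑∑-cong (λ i j → trans (*-distribˡ-sum (g i j) (λ v → w v i j)) (sum-cong-≗ (λ v → move (g i j) ⟦ pairB v i ⟧ _))) ⟩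
    sum (λ i → sum (λ j → sum (λ v → ⟦ pairB v i ⟧ * (g i j * visits part j (route v i)))))
      ≡⟨ sum-cong-≗ (λ i → ∑-comm (λ j v → ⟦ pairB v i ⟧ * (g i j * visits part j (route v i)))) ⟩
    sum (λ i → sum (λ v → sum (λ j → ⟦ pairB v i ⟧ * (g i j * visits part j (route v i)))))
      ≡⟨ ∑-comm (λ i v → sum (λ j → ⟦ pairB v i ⟧ * (g i j * visits part j (route v i)))) ⟩
    ∑∑ (λ v i → sum (λ j → ⟦ pairB v i ⟧ * (g i j * visits part j (route v i))))
      ≡⟨ ∑∑-cong (λ v i → trans (sym (*-distribˡ-sum ⟦ pairB v i ⟧ (λ j → g i j * visits part j (route v i))))
                                (cong (⟦ pairB v i ⟧ *_) (sum-visits part (g i) (route v i)))) ⟩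
    ∑∑ (λ v i → ⟦ pairB v i ⟧ * total part (g i) (route v i)) ∎
    where
    open ≡-Reasoning
    w : Fin n → Fin k → Fin k → ℕ
    w v i j = ⟦ pairB v i ⟧ * visits part j (route v i)
    move : ∀ a b c → a * (b * c) ≡ b * (a * c)
    move = solve-∀

  open ≤-Reasoning

  pairs : ℕ
  pairs = ∑∑ (λ v i → ⟦ pairB v i ⟧)

  weight-total : ∑∑ weight ≤ D * pairs
  weight-total = begin
    ∑∑ weight
      ≡⟨ ∑∑-cong (λ i j → +-identityʳ (weight i j)) ⟨
    ∑∑ (λ i j → 1 * weight i j)
      ≡⟨ weighted (λ _ _ → 1) ⟩
    ∑∑ (λ v i → ⟦ pairB v i ⟧ * total part (λ _ → 1) (route v i))
      ≤⟨ ∑∑-mono (λ v i → *-monoʳ-≤ ⟦ pairB v i ⟧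
           (≤-trans (≤-reflexive (total-1 part (route v i))) (route-length v i))) ⟩
    ∑∑ (λ v i → ⟦ pairB v i ⟧ * D)
      ≡⟨ trans (∑∑-* D (λ v i → ⟦ pairB v i ⟧)) (∑∑-cong (λ v i → *-comm D ⟦ pairB v i ⟧)) ⟨
    D * pairs ∎

  -- Each colour class plays the role of a random sample of the parts, of density 1/2D.
  coloured = colouring (D′ + D) weight weight-diag

  f : Fin k → Fin (D + D)
  f = proj₁ coloured

  clash : Fin n → Fin k → ℕ
  clash v i = total part (λ p → ⟦ eqB (f i) (f p) ⟧) (route v i)

  clashes : ℕ
  clashes = ∑∑ (λ v i → ⟦ pairB v i ⟧ * clash v i)

  -- The total weight is at most `D` per pair, and `D + D` colours leave at most a fraction 1/2D of
  -- it monochromatic: half a clash per pair on average.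
  few-clashes : clashes + clashes ≤ pairs
  few-clashes = *-cancelˡ-≤ D (begin
    D * (clashes + clashes)
      ≡⟨ double D clashes ⟩
    (D + D) * clashes
      ≡⟨ cong ((D + D) *_) (weighted (λ i j → ⟦ eqB (f i) (f j) ⟧)) ⟨
    (D + D) * ∑∑ (λ i j → ⟦ eqB (f i) (f j) ⟧ * weight i j)
      ≤⟨ proj₂ coloured ⟩
    ∑∑ weight
      ≤⟨ weight-total ⟩
    D * pairs ∎)
    where
    double : ∀ a b → a * (b + b) ≡ (a + a) * b
    double = solve-∀

  freeB : Fin n → Fin k → Bool
  freeB v i = pairB v i ∧ ⌊ clash v i ≟ℕ 0 ⌋

  free : ℕ
  free = ∑∑ (λ v i → ⟦ freeB v i ⟧)

  -- A pair that is not free has at least one clash.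
  pairs≤free+clashes : pairs ≤ free + clashes
  pairs≤free+clashes = ≤-trans (∑∑-mono split) (≤-reflexive (∑∑-+ (λ v i → ⟦ freeB v i ⟧) _))
    where
    split : ∀ v i → ⟦ pairB v i ⟧ ≤ ⟦ freeB v i ⟧ + ⟦ pairB v i ⟧ * clash v i
    split v i with pairB v i | clash v i
    ... | false | _     = z≤n
    ... | true  | zero  = s≤s z≤n
    ... | true  | suc m = s≤s z≤n

  pairs≤2free : pairs ≤ free + free
  pairs≤2free = +-cancelʳ-≤ pairs pairs (free + free) (begin
    pairs + pairs                         ≤⟨ +-mono-≤ pairs≤free+clashes pairs≤free+clashes ⟩
    (free + clashes) + (free + clashes)   ≡⟨ regroup free clashes ⟩
    (free + free) + (clashes + clashes)   ≤⟨ +-monoʳ-≤ (free + free) few-clashes ⟩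
    (free + free) + pairs                 ∎)
    where
    regroup : ∀ a b → (a + b) + (a + b) ≡ (a + a) + (b + b)
    regroup = solve-∀

  class : Fin (D + D) → Fin k → Bool
  class r i = A i ∧ eqB (f i) r

  class-free : Fin (D + D) → Fin n → Fin k → Bool
  class-free r v i = freeB v i ∧ eqB (f i) r

  class-free-trail : ∀ r v i → class-free r v i ≡ true → cut v ≡ true × class r i ≡ true × part v ≢ i ×
                     ∃[ xs ] (Trail i v xs × All (λ x → class r (part x) ≡ false) xs)
  class-free-trail r v i p =
    let p₁ , fi = ∧-elim {freeB v i} p
        p₂ , cl = ∧-elim {pairB v i} p₁
        pair cv sv v∉i = pair-elim v i p₂
    in cv , ∧-intro (sees-active v i sv) fi , v∉i , route v i , route-trail v i sv ,
       All.map (λ {x} → other (eqB-elim fi) (part x))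
         (total-zero part _ (route v i) (⌊⌋-elim (clash v i ≟ℕ 0) cl))
    where
    other : f i ≡ r → ∀ p → ⟦ eqB (f i) (f p) ⟧ ≡ 0 → class r p ≡ false
    other refl p z = ¬true⇒false λ q → case trans (sym (cong ⟦_⟧ (eqB-intro (sym (eqB-elim {v = f i} (proj₂ (∧-elim {A p} q))))))) z of λ ()

  active cuts : ℕ
  active = countTrue A
  cuts   = countTrue cut

  sum-over-colours : (b : Fin k → Bool) → sum (λ r → countTrue (λ i → b i ∧ eqB (f i) r)) ≡ countTrue b
  sum-over-colours b = trans (sum-cong-≗ {D + D} (λ r → countTrue-sum (λ i → b i ∧ eqB (f i) r)))
    (trans (∑-comm (λ r i → ⟦ b i ∧ eqB (f i) r ⟧))
      (trans (sum-cong-≗ (λ i → trans (sum-cong-≗ (λ r → ∧-* (b i) (eqB (f i) r))) (sum-δ (f i) ⟦ b i ⟧)))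
        (sym (countTrue-sum b))))
    where
    ∧-* : ∀ a b → ⟦ a ∧ b ⟧ ≡ ⟦ b ⟧ * ⟦ a ⟧
    ∧-* true  true  = refl
    ∧-* true  false = refl
    ∧-* false true  = refl
    ∧-* false false = refl

  -- Every colour class gives one minor. Summed over the classes, a cut vertex is counted once for
  -- each of the `D + D` colours, an active part only once.
  free-bound : free ≤ d * ((D + D) * cuts + active)
  free-bound = begin
    free
      ≡⟨ sum-cong-≗ {n} (λ v → countTrue-sum (freeB v)) ⟨
    sum (λ v → countTrue (freeB v))
      ≡⟨ sum-cong-≗ (λ v → sum-over-colours (freeB v)) ⟨
    sum (λ v → sum (λ r → countTrue (λ i → class-free r v i)))
      ≡⟨ ∑-comm (λ v r → countTrue (λ i → class-free r v i)) ⟩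
    sum (λ r → sum (λ v → countTrue (λ i → class-free r v i)))
      ≡⟨ sum-cong-≗ (λ r → sum-cong-≗ (λ v → countTrue-sum (class-free r v))) ⟩
    sum (λ r → ∑∑ (λ v i → ⟦ class-free r v i ⟧))
      ≤⟨ sum-mono (λ r → Contraction.minor-bound (class r) {d} sparse (class-free r) (class-free-trail r)) ⟩
    sum (λ r → d * (cuts + countTrue (class r)))
      ≡⟨ *-distribˡ-sum d (λ r → cuts + countTrue (class r)) ⟨
    d * sum (λ r → cuts + countTrue (class r))
      ≡⟨ cong (d *_) (trans (∑-distrib-+ (λ _ → cuts) (λ r → countTrue (class r)))
           (cong₂ _+_ (sum-const (D + D) cuts) (sum-over-colours A))) ⟩
    d * ((D + D) * cuts + active) ∎

  incidences : ℕ
  incidences = ∑∑ (λ v i → ⟦ cut v ∧ sees v i ⟧)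

  -- The incidences that are not pairs have `part v ≡ i`, at most one for each cut vertex.
  incidences≤ : incidences ≤ cuts + pairs
  incidences≤ = begin
    incidences                                        ≤⟨ sum-mono row ⟩
    sum (λ v → ⟦ cut v ⟧ + sum (λ i → ⟦ pairB v i ⟧)) ≡⟨ ∑-distrib-+ (λ v → ⟦ cut v ⟧) _ ⟩
    sum (λ v → ⟦ cut v ⟧) + pairs                     ≡⟨ cong (_+ pairs) (countTrue-sum cut) ⟨
    cuts + pairs                                      ∎
    where
    entry : ∀ a s e → ⟦ a ∧ s ⟧ ≤ ⟦ e ⟧ * ⟦ a ⟧ + ⟦ (a ∧ s) ∧ not e ⟧
    entry false s     e     = z≤n
    entry true  false e     = z≤n
    entry true  true  false = s≤s z≤n
    entry true  true  true  = s≤s z≤n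
    row : ∀ v → sum (λ i → ⟦ cut v ∧ sees v i ⟧) ≤ ⟦ cut v ⟧ + sum (λ i → ⟦ pairB v i ⟧)
    row v = ≤-trans (sum-+-≤ (λ i → entry (cut v) (sees v i) (eqB (part v) i)))
      (≤-reflexive (cong (_+ sum (λ i → ⟦ pairB v i ⟧)) (sum-δ (part v) ⟦ cut v ⟧)))

  -- The count from the side of the cut vertices, each of which sees at least `c` parts;
  -- `heavy-incidences` counts from the side of the parts.
  incidences≥ : cuts * c ≤ incidences
  incidences≥ = begin
    cuts * c                        ≡⟨ cong (_* c) (countTrue-sum cut) ⟩
    sum (λ v → ⟦ cut v ⟧) * c       ≡⟨ trans (*-comm _ c) (*-distribˡ-sum c (λ v → ⟦ cut v ⟧)) ⟩
    sum (λ v → c * ⟦ cut v ⟧)       ≤⟨ sum-mono row ⟩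
    incidences                      ∎
    where
    row : ∀ v → c * ⟦ cut v ⟧ ≤ sum (λ i → ⟦ cut v ∧ sees v i ⟧)
    row v with toSum (cut v ≟ᵇ true)
    ... | inj₁ cv = begin
      c * ⟦ cut v ⟧                          ≡⟨ trans (cong (λ b → c * ⟦ b ⟧) cv) (*-identityʳ c) ⟩
      c                                      ≤⟨ cut-many v cv ⟩
      countTrue (sees v)                     ≡⟨ countTrue-sum (sees v) ⟩
      sum (λ i → ⟦ sees v i ⟧)               ≤⟨ sum-mono {f = λ i → ⟦ sees v i ⟧} (λ i → ⟦⟧-mono {sees v i} (∧-intro cv)) ⟩
      sum (λ i → ⟦ cut v ∧ sees v i ⟧)       ∎
    ... | inj₂ ¬cv = ≤-trans (≤-reflexive (trans (cong (λ b → c * ⟦ b ⟧) (¬true⇒false ¬cv)) (*-zeroʳ c))) z≤n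

  heavy : Fin k → Bool
  heavy i = A i ∧ ⌊ 8 * d <? crossings i ⌋

  heavy-incidences : countTrue heavy * (8 * d) ≤ incidences
  heavy-incidences = begin
    countTrue heavy * (8 * d)          ≡⟨ cong (_* (8 * d)) (countTrue-sum heavy) ⟩
    sum (λ i → ⟦ heavy i ⟧) * (8 * d)  ≡⟨ trans (*-comm _ (8 * d)) (*-distribˡ-sum (8 * d) (λ i → ⟦ heavy i ⟧)) ⟩
    sum (λ i → 8 * d * ⟦ heavy i ⟧)    ≤⟨ sum-mono column ⟩
    sum crossings                      ≡⟨ sum-cong-≗ (λ i → countTrue-sum (λ v → cut v ∧ sees v i)) ⟩
    ∑∑ (λ i v → ⟦ cut v ∧ sees v i ⟧)  ≡⟨ ∑-comm (λ i v → ⟦ cut v ∧ sees v i ⟧) ⟩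
    incidences                         ∎
    where
    column : ∀ i → 8 * d * ⟦ heavy i ⟧ ≤ crossings i
    column i with toSum (heavy i ≟ᵇ true)
    ... | inj₁ h = ≤-trans (≤-reflexive (trans (cong (λ b → 8 * d * ⟦ b ⟧) h) (*-identityʳ (8 * d))))
                     (<⇒≤ (⌊⌋-elim (8 * d <? crossings i) (proj₂ (∧-elim {A i} h))))
    ... | inj₂ ¬h = ≤-trans (≤-reflexive (trans (cong (λ b → 8 * d * ⟦ b ⟧) (¬true⇒false ¬h)) (*-zeroʳ (8 * d)))) z≤n

  -- By the choice of `c`, twice the upper bound on `incidences` is `4 * d * active + cuts * c`, and
  -- `incidences` itself absorbs `cuts * c`. What remains is at most `4 * d` incidences per active
  -- part on average, whereas a heavy part has more than `8 * d`.
  few-heavy : c ≡ 8 * d * D + 2 → 1 ≤ d → countTrue heavy + countTrue heavy ≤ active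
  few-heavy c≡ (s≤s {n = d′} _) = *-cancelˡ-≤ (4 * d) (begin
    4 * d * (h + h)           ≡⟨ heavy-scale d h ⟩
    h * (8 * d)               ≤⟨ heavy-incidences ⟩
    incidences                ≤⟨ +-cancelʳ-≤ incidences incidences (4 * d * active) twice ⟩
    4 * d * active            ∎)
    where
    h = countTrue heavy
    heavy-scale : ∀ d h → 4 * d * (h + h) ≡ h * (8 * d)
    heavy-scale = solve-∀
    collect : ∀ d D O a → (O + (d * ((D + D) * O + a) + d * ((D + D) * O + a))) +
                          (O + (d * ((D + D) * O + a) + d * ((D + D) * O + a)))
                        ≡ 4 * d * a + O * (8 * d * D + 2)
    collect = solve-∀
    once : incidences ≤ cuts + (d * ((D + D) * cuts + active) + d * ((D + D) * cuts + active))
    once = ≤-trans incidences≤ (+-monoʳ-≤ cuts (≤-trans pairs≤2free (+-mono-≤ free-bound free-bound)))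
    twice : incidences + incidences ≤ 4 * d * active + incidences
    twice = begin
      incidences + incidences                      ≤⟨ +-mono-≤ once once ⟩
      (cuts + (d * ((D + D) * cuts + active) + d * ((D + D) * cuts + active))) +
      (cuts + (d * ((D + D) * cuts + active) + d * ((D + D) * cuts + active)))
                                                   ≡⟨ collect d D cuts active ⟩
      4 * d * active + cuts * (8 * d * D + 2)      ≡⟨ cong (λ c → 4 * d * active + cuts * c) c≡ ⟨
      4 * d * active + cuts * c                    ≤⟨ +-monoʳ-≤ (4 * d * active) incidences≥ ⟩
      4 * d * active + incidences                  ∎

-- Iterating over the parts that are not yet served

DilationAt : ∀ {n k} → Adj n → (Fin n → Fin k) → ℕ → Fin k → Subgraph n → Set
DilationAt G part B i H = ∀ u v → PlusV part i H u → PlusV part i H v →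
  ∃[ ℓ ] (ℓ ≤ B × Walk (PlusE G part i H) u v ℓ)

module Rounds {n k} {G : Adj n} {D′ : ℕ} (T : RootedTree G (suc D′)) (part : Fin n → Fin k)
  (part-connected : ∀ i → PartConnected G part i) {d : ℕ} (1≤d : 1 ≤ d) (sparse : Sparse d G) where

  D c B : ℕ
  D = suc D′
  c = 8 * d * D + 2
  -- A light part meets at most `suc (8 * d)` pieces; each is crossed in at most `D + D` steps and
  -- left by one more edge.
  B = suc (8 * d) * suc (D + D)

  -- Dilation and congestion are claimed for the parts in `A` only, so that a round can hand its
  -- heavy parts over to the later rounds.
  record Shortcuts (A : Fin k → Bool) (r : ℕ) : Set where
    field
      H          : Fin k → Subgraph n
      subgraph   : ∀ i → IsSubgraphOf (H i) G
      dilation   : ∀ i → A i ≡ true → DilationAt G part B i (H i)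
      congestion : ∀ x y → countTrue (λ i → A i ∧ inHB (H i) x y) ≤ r * (c + c)

  -- Each round leaves at most half of the parts as heavy and adds `c + c` to the congestion. The
  -- strict bound makes `A` empty when no round is left.
  rounds : ∀ r A → countTrue A < 2 ^ r → Shortcuts A r
  rounds zero A (s≤s none) = record
    { H          = λ _ → record { vert = λ _ → false ; edge = λ _ _ → false }
    ; subgraph   = λ _ _ _ ()
    ; dilation   = λ i Ai → case ≤-trans (countTrue-any i Ai) none of λ ()
    ; congestion = λ x y → ≤-reflexive (countTrue-none {f = λ i → A i ∧ false} λ i → ∧-zeroʳ (A i))
    }
  rounds (suc r) A few = record
    { H = H ; subgraph = subgraph ; dilation = dilation ; congestion = congestion }
    where
    open Cut T part A c
    open Counting T part A c part-connected {d} sparse using (heavy; few-heavy)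

    fewer : countTrue heavy < 2 ^ r
    fewer = *-cancelˡ-< 2 _ _ (≤-<-trans
      (≤-trans (≤-reflexive (cong (countTrue heavy +_) (+-identityʳ _))) (few-heavy refl 1≤d)) few)

    module Later = Shortcuts (rounds r heavy fewer)

    H : Fin k → Subgraph n
    H i = if heavy i then Later.H i else shortcut i

    H-elim : ∀ i (P : Subgraph n → Set) → (heavy i ≡ true → P (Later.H i)) → (heavy i ≡ false → P (shortcut i)) → P (H i)
    H-elim i P later now with heavy i
    ... | true  = later refl
    ... | false = now refl

    subgraph : ∀ i → IsSubgraphOf (H i) G
    subgraph i = H-elim i (λ H → IsSubgraphOf H G) (λ _ → Later.subgraph i) (λ _ → shortcut-subgraph i)

    light : ∀ {i} → A i ≡ true → heavy i ≡ false → crossings i ≤ 8 * d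
    light {i} Ai h = ≮⇒≥ λ lt → true≢false (∧-intro Ai (⌊⌋-intro (8 * d <? crossings i) lt)) h

    dilation : ∀ i → A i ≡ true → DilationAt G part B i (H i)
    dilation i Ai = H-elim i (DilationAt G part B i) (Later.dilation i) λ h u v pu pv →
      let ℓ , ℓ≤ , w = shortcut-dilation Ai (part-connected i) u v pu pv
      in ℓ , ≤-trans ℓ≤ (*-monoˡ-≤ (suc (D + D)) (s≤s (light Ai h))) , w

    congestion : ∀ x y → countTrue (λ i → A i ∧ inHB (H i) x y) ≤ suc r * (c + c)
    congestion x y = ≤-trans
      (countTrue-∪ {f = λ i → A i ∧ inHB (H i) x y} {g = λ i → inHB (shortcut i) x y} {h = λ i → heavy i ∧ inHB (Later.H i) x y}
        (λ i p → H-elim i (λ H → inHB H x y ≡ true → inHB (shortcut i) x y ≡ true ⊎ heavy i ∧ inHB (Later.H i) x y ≡ true)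
           (λ h q → inj₂ (∧-intro h q)) (λ _ q → inj₁ q) (proj₂ (∧-elim {A i} p))))
      (+-mono-≤ (shortcut-congestion x y) (Later.congestion x y))

-- Logarithms and rationals

-- Strong induction by halving, with `m` as fuel: for `n` at least two, passing to `⌈ n /2⌉` lowers
-- the logarithm by exactly one.
n≤2^⌈log₂n⌉ : ∀ n → n ≤ 2 ^ ⌈log₂ n ⌉
n≤2^⌈log₂n⌉ n = bound n n ≤-refl
  where
  open ≤-Reasoning
  bound : ∀ m n → n ≤ m → n ≤ 2 ^ ⌈log₂ n ⌉
  bound m zero n≤m = z≤n
  bound m (suc zero) n≤m = m^n>0 2 ⌈log₂ 1 ⌉
  bound (suc m) n@(suc (suc n′)) n≤m = begin
    n                                   ≡⟨ ⌊n/2⌋+⌈n/2⌉≡n n ⟨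
    ⌊ n /2⌋ + ⌈ n /2⌉                   ≤⟨ +-monoˡ-≤ _ (⌊n/2⌋≤⌈n/2⌉ n) ⟩
    ⌈ n /2⌉ + ⌈ n /2⌉                   ≤⟨ +-mono-≤ half half ⟩
    2 ^ (⌈log₂ n ⌉ ∸ 1) + 2 ^ (⌈log₂ n ⌉ ∸ 1)
      ≡⟨ cong (2 ^ (⌈log₂ n ⌉ ∸ 1) +_) (+-identityʳ _) ⟨
    2 ^ suc (⌈log₂ n ⌉ ∸ 1)             ≡⟨ cong (2 ^_) (m+[n∸m]≡n positive) ⟩
    2 ^ ⌈log₂ n ⌉                       ∎
    where
    positive : 1 ≤ ⌈log₂ n ⌉
    positive = subst (_≤ ⌈log₂ n ⌉) (⌈log₂2^n⌉≡n 1) (⌈log₂⌉-mono-≤ {2} {n} (s≤s (s≤s z≤n)))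
    half : ⌈ n /2⌉ ≤ 2 ^ (⌈log₂ n ⌉ ∸ 1)
    half = subst (λ e → ⌈ n /2⌉ ≤ 2 ^ e) (⌈log₂⌈n/2⌉⌉≡⌈log₂n⌉∸1 n)
             (bound m ⌈ n /2⌉ (s≤s⁻¹ (≤-trans (⌈n/2⌉<n n′) n≤m)))

-- Rationals are kept in lowest terms, so the comparison is moved to unnormalised ones, where it is
-- cross-multiplication.
/-≤⇒*-≤ : ∀ {p q} m n → (ℤ.+ p) ℚ./ suc m ℚ.≤ (ℤ.+ q) ℚ./ suc n → p * suc n ≤ q * suc m
/-≤⇒*-≤ {p} {q} m n le = ℤ.drop‿+≤+ (subst₂ ℤ._≤_ (sym (ℤ.pos-* p (suc n))) (sym (ℤ.pos-* q (suc m)))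
  (ℚᵘ.drop-*≤* (ℚᵘ.≤-respˡ-≃ (ℚ.toℚᵘ-fromℚᵘ (mkℚᵘ (ℤ.+ p) m)) (ℚᵘ.≤-respʳ-≃ (ℚ.toℚᵘ-fromℚᵘ (mkℚᵘ (ℤ.+ q) n)) (ℚ.toℚᵘ-mono-≤ le)))))

ℕ→ℚ-≤-scale : ∀ C p s X Y → X * suc s ≤ C * p * Y → ℕ→ℚ X ℚ.≤ ℕ→ℚ C ℚ.* ((ℤ.+ p) ℚ./ suc s) ℚ.* ℕ→ℚ Y
ℕ→ℚ-≤-scale C p s X Y le = ℚ.toℚᵘ-cancel-≤
  (ℚᵘ.≤-respˡ-≃ (ℚᵘ.≃-sym (ℚ.toℚᵘ-fromℚᵘ (mkℚᵘ (ℤ.+ X) 0))) (ℚᵘ.≤-respʳ-≃ (ℚᵘ.≃-sym product) (*≤* cleared)))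
  where
  δ = (ℤ.+ p) ℚ./ suc s

  product : ℚ.toℚᵘ (ℕ→ℚ C ℚ.* δ ℚ.* ℕ→ℚ Y) ℚᵘ.≃ (mkℚᵘ (ℤ.+ C) 0 ℚᵘ.* mkℚᵘ (ℤ.+ p) s) ℚᵘ.* mkℚᵘ (ℤ.+ Y) 0
  product = ℚᵘ.≃-trans (ℚ.toℚᵘ-homo-* (ℕ→ℚ C ℚ.* δ) (ℕ→ℚ Y)) (ℚᵘ.*-cong
    (ℚᵘ.≃-trans (ℚ.toℚᵘ-homo-* (ℕ→ℚ C) δ) (ℚᵘ.*-cong (ℚ.toℚᵘ-fromℚᵘ (mkℚᵘ (ℤ.+ C) 0)) (ℚ.toℚᵘ-fromℚᵘ (mkℚᵘ (ℤ.+ p) s))))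
    (ℚ.toℚᵘ-fromℚᵘ (mkℚᵘ (ℤ.+ Y) 0)))

  cleared : ℤ.+ X ℤ.* ℤ.+ (1 * suc s * 1) ℤ.≤ (ℤ.+ C ℤ.* ℤ.+ p ℤ.* ℤ.+ Y) ℤ.* ℤ.+ 1
  cleared = subst₂ ℤ._≤_
    (trans (cong ℤ.+_ (denominators X s)) (ℤ.pos-* X (1 * suc s * 1)))
    (trans (ℤ.pos-* (C * p) Y) (trans (cong (ℤ._* ℤ.+ Y) (ℤ.pos-* C p)) (sym (ℤ.*-identityʳ _))))
    (ℤ.+≤+ le)
    where
    denominators : ∀ X s → X * suc s ≡ X * (1 * suc s * 1)
    denominators = solve-∀

ℕ→ℚ-* : ∀ a b → ℕ→ℚ (a * b) ≡ ℕ→ℚ a ℚ.* ℕ→ℚ b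
ℕ→ℚ-* a b = ℚ.toℚᵘ-injective (ℚᵘ.≃-trans (ℚ.toℚᵘ-fromℚᵘ (mkℚᵘ (ℤ.+ (a * b)) 0)) (ℚᵘ.≃-sym
  (ℚᵘ.≃-trans (ℚ.toℚᵘ-homo-* (ℕ→ℚ a) (ℕ→ℚ b)) (ℚᵘ.≃-trans
    (ℚᵘ.*-cong (ℚ.toℚᵘ-fromℚᵘ (mkℚᵘ (ℤ.+ a) 0)) (ℚ.toℚᵘ-fromℚᵘ (mkℚᵘ (ℤ.+ b) 0)))
    (ℚᵘ.*≡* (cong (ℤ._* ℤ.+ 1) (sym (ℤ.pos-* a b))))))))

-- A natural number within a constant factor of the minor density

-- A single edge, taken as a minor, shows that the density is at least 1/2; this is what turns the
-- rounding in `d` into a constant factor.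
edgeMinor : ∀ {n} (G : Adj n) {u v} → E G u v → ∃[ m ] Σ (Adj m) λ H → Minor H G × m ≤ 2 × 1 ≤ numEdges H
edgeMinor {n} G {u} {v} e = bipartiteMinor {a = 1} {b = 1} G β branchSets
  (λ _ → true) (λ _ _ → refl) (λ _ → true) (λ _ _ → refl) (λ _ _ → true)
  (λ { zero zero _ → u , v , e , if-true (eqB-intro {u = u} refl)
                       , trans (if-false (eqB-intro-¬ (E-irrefl {G = G} e ∘ sym))) (if-true (eqB-intro {u = v} refl)) })
  where
  β : Fin n → Maybe (Fin 1 ⊎ Fin 1)
  β x = if eqB x u then just (inj₁ zero) else (if eqB x v then just (inj₂ zero) else nothing)

  end : Fin 1 ⊎ Fin 1 → Fin n
  end (inj₁ _) = u
  end (inj₂ _) = v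

  β-end : ∀ x {a} → β x ≡ just a → x ≡ end a
  β-end x p with x ≟ u | x ≟ v
  β-end x refl | yes q | _     = q
  β-end x refl | no _  | yes q = q

  branchSets : BranchSets G β
  branchSets {x} {y} p q with trans (β-end x p) (sym (β-end y q))
  ... | refl = ε

module Density {n} (G : Adj n) (p s : ℕ)
  (maximal : ∀ {m} (H : Adj (suc m)) → Minor H G → numEdges H * suc s ≤ p * suc m) where

  -- The floor of the density, plus one: positive and no smaller than the density.
  d : ℕ
  d = suc (p / suc s)

  p≤d*s : p ≤ d * suc s
  p≤d*s = ≤-trans (≤-reflexive (m≡m%n+[m/n]*n p (suc s))) (+-monoˡ-≤ _ (<⇒≤ (m%n<n p (suc s))))

  sparse : Sparse d G
  sparse {zero}  H minor = z≤n
  sparse {suc m} H minor = *-cancelʳ-≤ _ _ (suc s) (begin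
    numEdges H * suc s     ≤⟨ maximal H minor ⟩
    p * suc m              ≤⟨ *-monoˡ-≤ (suc m) p≤d*s ⟩
    d * suc s * suc m      ≡⟨ swap d (suc s) (suc m) ⟩
    d * suc m * suc s      ∎)
    where
    open ≤-Reasoning
    swap : ∀ a b c → a * b * c ≡ a * c * b
    swap = solve-∀

  -- `d` exceeds the density by at most one, and one is at most twice the density by `edgeMinor`.
  d*s≤3p : ∀ {u v} → E G u v → d * suc s ≤ 3 * p
  d*s≤3p e with edgeMinor G e
  ... | zero  , H , minor , _ , ()
  ... | suc m , H , minor , m≤2 , 1≤e = begin
    suc s + p / suc s * suc s   ≤⟨ +-mono-≤ s≤2p (m/n*n≤m p (suc s)) ⟩
    p * 2 + p                   ≡⟨ triple p ⟩
    3 * p                       ∎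
    where
    open ≤-Reasoning
    triple : ∀ p → p * 2 + p ≡ 3 * p
    triple = solve-∀
    s≤2p : suc s ≤ p * 2
    s≤2p = begin
      suc s                ≡⟨ *-identityˡ (suc s) ⟨
      1 * suc s            ≤⟨ *-monoˡ-≤ (suc s) 1≤e ⟩
      numEdges H * suc s   ≤⟨ maximal H minor ⟩
      p * suc m            ≤⟨ *-monoʳ-≤ p m≤2 ⟩
      p * 2                ∎

-- Assembly of the bounds and the constant

theorem1p2 : ∃[ C ] (0 < C ×
    (∀ (n : ℕ) (G : Adj n) (D : ℕ) (δ : ℚ) →
    Connected G → IsDiameter G D → IsMinorDensity G δ →
    ∀ (k : ℕ) (part : Fin n → Fin k) →
    (∀ i → PartConnected G part i) →
    Σ (Fin k → Subgraph n) λ H →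
    (∀ i → IsSubgraphOf (H i) G) ×
    DilationAtMost G part H (ℕ→ℚ C ℚ.* δ ℚ.* ℕ→ℚ D) ×
    CongestionAtMost G H (ℕ→ℚ C ℚ.* δ ℚ.* ℕ→ℚ D ℚ.* ℕ→ℚ ⌈log₂ n ⌉)))
-- The factor 40 covers both bounds in terms of `d`, and the factor 3 passes from `d` to the
-- density; see `scale`.
theorem1p2 = 120 , s≤s z≤n , shortcuts
  where
  open ≤-Reasoning

  shortcuts : ∀ n (G : Adj n) D δ → Connected G → IsDiameter G D → IsMinorDensity G δ →
              ∀ k (part : Fin n → Fin k) → (∀ i → PartConnected G part i) →
              Σ (Fin k → Subgraph n) λ H → (∀ i → IsSubgraphOf (H i) G) ×
                DilationAtMost G part H (ℕ→ℚ 120 ℚ.* δ ℚ.* ℕ→ℚ D) ×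
                CongestionAtMost G H (ℕ→ℚ 120 ℚ.* δ ℚ.* ℕ→ℚ D ℚ.* ℕ→ℚ ⌈log₂ n ⌉)
  -- At diameter zero both bounds vanish, but all vertices coincide, so empty walks suffice and
  -- there is no edge to congest.
  shortcuts n G zero δ _ (reach , _) ((s , H₀ , _ , refl) , _) k part _ =
    (λ _ → record { vert = λ _ → false ; edge = λ _ _ → false }) , (λ _ _ _ ()) ,
    (λ i u v _ _ → 0 , subst (λ w → Walk _ u w 0) (single u v) [] ,
                   ℕ→ℚ-≤-scale 120 (numEdges H₀) s 0 0 z≤n) ,
    (λ u v e → contradiction (single u v) (E-irrefl {G = G} e))
    where
    single : ∀ u v → u ≡ v
    single u v with reach u v
    ... | zero , _ , [] = refl
  shortcuts n G (suc D′) δ _ (reach , far , far′ , farthest) ((s , H₀ , _ , refl) , maximal) k part part-connected =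
    H , subgraph ,
    (λ i u v pu pv → let ℓ , ℓ≤ , w = dilation i refl u v pu pv in
      ℓ , w , ℕ→ℚ-≤-scale 120 p s ℓ D (dilation-bound ℓ≤)) ,
    (λ u v _ → subst (ℕ→ℚ (countTrue (λ i → inHB (H i) u v)) ℚ.≤_) (regroup L)
      (ℕ→ℚ-≤-scale 120 p s (countTrue (λ i → inHB (H i) u v)) (D * L) (congestion-bound (congestion u v))))
    where
    D L p : ℕ
    D = suc D′
    L = ⌈log₂ n ⌉
    p = numEdges H₀

    open Density G p s (λ {m} H minor → /-≤⇒*-≤ {numEdges H} {p} m s (maximal m H minor))

    far≢far′ : far ≢ far′
    far≢far′ refl = case farthest 0 [] of λ ()

    firstEdge : ∃₂ λ u v → E G u v
    firstEdge with reach far far′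
    ... | _ , _ , []    = contradiction refl far≢far′
    ... | _ , _ , e ∷ _ = _ , _ , e

    d*s≤ : d * suc s ≤ 3 * p
    d*s≤ = d*s≤3p (proj₂ (proj₂ firstEdge))

    2≤n : 2 ≤ n
    2≤n = two far far′ far≢far′
      where
      two : ∀ {m} (x y : Fin m) → x ≢ y → 2 ≤ m
      two {suc zero} zero zero x≢y = contradiction refl x≢y
      two {suc (suc m)} _ _ _ = s≤s (s≤s z≤n)

    1≤L : 1 ≤ L
    1≤L = subst (_≤ L) (⌈log₂2^n⌉≡n 1) (⌈log₂⌉-mono-≤ 2≤n)

    k≤n : k ≤ n
    k≤n = injective⇒≤ {f = λ i → proj₁ (proj₁ (part-connected i))} λ {i} {j} same →
      trans (sym (proj₂ (proj₁ (part-connected i)))) (trans (cong part same) (proj₂ (proj₁ (part-connected j))))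

    all : Fin k → Bool
    all _ = true

    -- One round more than `L`, since `rounds` asks for a strict bound.
    all-few : countTrue all < 2 ^ suc L
    all-few = begin-strict
      countTrue all   ≤⟨ countTrue≤n all ⟩
      k               ≤⟨ k≤n ⟩
      n               ≤⟨ n≤2^⌈log₂n⌉ n ⟩
      2 ^ L           <⟨ ^-monoʳ-< 2 (s≤s (s≤s z≤n)) (n<1+n L) ⟩
      2 ^ suc L       ∎

    open Rounds (breadthFirst G D far reach) part part-connected {d} (s≤s z≤n) sparse using (B; c; rounds; module Shortcuts)
    open Shortcuts (rounds (suc L) all all-few)

    d₀ : ℕ
    d₀ = p / suc s

    scale : ∀ {X} C Y → X ≤ C * (d * Y) → X * suc s ≤ C * 3 * p * Y
    scale {X} C Y X≤ = begin
      X * suc s               ≤⟨ *-monoˡ-≤ (suc s) X≤ ⟩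
      C * (d * Y) * suc s     ≡⟨ out C d Y (suc s) ⟩
      C * (d * suc s) * Y     ≤⟨ *-monoˡ-≤ Y (*-monoʳ-≤ C d*s≤) ⟩
      C * (3 * p) * Y         ≡⟨ cong (_* Y) (*-assoc C 3 p) ⟨
      C * 3 * p * Y           ∎
      where
      out : ∀ a b c e → a * (b * c) * e ≡ a * (b * e) * c
      out = solve-∀

    dilation-bound : ∀ {X} → X ≤ B → X * suc s ≤ 120 * p * D
    dilation-bound X≤ = scale 40 D (≤-trans X≤ (≤-trans (m≤m+n B _) (≤-reflexive (B-slack d₀ D′))))
      where
      -- d = 1 + d₀ and D = 1 + D′
      B-slack : ∀ a b → suc (8 * suc a) * suc (suc b + suc b) + (13 + 16 * a + 22 * b + 24 * (a * b)) ≡ 40 * (suc a * suc b)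
      B-slack = solve-∀

    congestion-bound : ∀ {X} → X ≤ suc L * (c + c) → X * suc s ≤ 120 * p * (D * L)
    congestion-bound {X} X≤ = scale 40 (D * L) (begin
      X                            ≤⟨ X≤ ⟩
      -- `suc L` is at most `L + L` because two distinct vertices make `L` positive.
      suc L * (c + c)              ≤⟨ *-mono-≤ (+-monoˡ-≤ L 1≤L) (+-mono-≤ c≤ c≤) ⟩
      (L + L) * (10 * (d * D) + 10 * (d * D))   ≡⟨ collect L d D ⟩
      40 * (d * (D * L))           ∎)
      where
      -- The inequality becomes an identity for the ring solver once the difference of the sides, a
      -- polynomial with nonnegative coefficients in `d₀` and `D′`, is added.
      c-slack : ∀ a b → 8 * suc a * suc b + 2 + (2 * a + 2 * b + 2 * (a * b)) ≡ 10 * (suc a * suc b)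
      c-slack = solve-∀
      c≤ : c ≤ 10 * (d * D)
      c≤ = ≤-trans (m≤m+n c _) (≤-reflexive (c-slack d₀ D′))
      collect : ∀ l a b → (l + l) * (10 * (a * b) + 10 * (a * b)) ≡ 40 * (a * (b * l))
      collect = solve-∀

    regroup : ∀ l → ℕ→ℚ 120 ℚ.* ratio H₀ ℚ.* ℕ→ℚ (D * l) ≡ ℕ→ℚ 120 ℚ.* ratio H₀ ℚ.* ℕ→ℚ D ℚ.* ℕ→ℚ l
    regroup l = trans (cong (ℕ→ℚ 120 ℚ.* ratio H₀ ℚ.*_) (ℕ→ℚ-* D l)) (sym (ℚ.*-assoc (ℕ→ℚ 120 ℚ.* ratio H₀) (ℕ→ℚ D) (ℕ→ℚ l)))
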